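{- Let $P$ be a set of $n$ numbers on the real line, and let $f:P\to\mathbb{R}$ be a given mapping. One can compute the Lipschitz constant of $f$ on every point of $P$ (that is, all $n$ of these constants) in $O(n\log^2 n)$ time.
   Context: A point $x\in P$ is $K$-Lipschitz (for $f$) if $|f(x)-f(y)|\le K\,|x-y|$ for every $y\in P$. The Lipschitz constant of $f$ on the point $x$ is the smallest $K$ such that $x$ is $K$-Lipschitz, i.e. $\max_{y\in P\setminus\{x\}}|f(x)-f(y)|/|x-y|$. Arithmetic operations and comparisons on the input numbers take unit time (numerical precision issues are ignored). -}

module Defs where

open import Algebra.Core using (Op₁; Op₂)
open import Algebra.Structures using (IsCommutativeRing)
open import Data.Bool.Base using (Bool; true; false; if_then_else_)
open import Data.Fin.Base using (Fin; toℕ; fromℕ<)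
open import Data.Nat.Base as ℕ using (ℕ; suc; ⌊_/2⌋; _≡ᵇ_)
import Data.Nat.Properties as ℕ
open import Data.Product.Base using (_×_; ∃₂)
open import Data.Unit.Polymorphic.Base using (⊤)
open import Data.Vec.Functional using (Vector; _++_)
open import Function.Definitions using (Injective)
open import Level using (_⊔_) renaming (suc to lsuc)
open import Relation.Binary.Core using (Rel)
open import Relation.Binary.PropositionalEquality.Core using (_≡_)
open import Relation.Binary.Structures using (IsStrictTotalOrder)
import Relation.Binary.Construct.StrictToNonStrict as NonStrict
open import Relation.Nullary.Decidable.Core using (does; yes; no)
open import Relation.Nullary.Negation.Core using (¬_)

_∈O_ : (ℕ → ℕ) → (ℕ → ℕ) → Set
T ∈O g = ∃₂ λ c n₀ → ∀ n → n₀ ℕ.≤ n → T n ℕ.≤ c ℕ.* g n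

-- There is no ℝ in the standard library.  All that is assumed of the
-- line is that it is an ordered field; the order is decidable since
-- comparison is a primitive operation of the machine below.
record OrderedField c ℓ₁ ℓ₂ : Set (lsuc (c ⊔ ℓ₁ ⊔ ℓ₂)) where
  infix  8 -_ _⁻¹
  infixl 7 _*_ _/_
  infixl 6 _+_ _-_
  infix  4 _≈_ _≉_ _<_
  field
    Carrier : Set c
    _≈_     : Rel Carrier ℓ₁
    _<_     : Rel Carrier ℓ₂
    _+_ _*_ : Op₂ Carrier
    -_ _⁻¹  : Op₁ Carrier
    0# 1#   : Carrier

  _≉_ : Rel Carrier ℓ₁
  x ≉ y = ¬ (x ≈ y)

  field
    isCommutativeRing  : IsCommutativeRing _≈_ _+_ _*_ -_ 0# 1#
    0≉1                : 0# ≉ 1#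
    -- 0# ⁻¹ is unspecified.
    ⁻¹-inverseʳ        : ∀ x → x ≉ 0# → x * x ⁻¹ ≈ 1#
    isStrictTotalOrder : IsStrictTotalOrder _≈_ _<_
    +-monoʳ-<          : ∀ x {y z} → y < z → x + y < x + z
    *-pos              : ∀ {x y} → 0# < x → 0# < y → 0# < x * y

  open IsCommutativeRing isCommutativeRing public
    hiding (_-_)
  open IsStrictTotalOrder isStrictTotalOrder public
    using (_<?_; _≟_; compare; <-resp-≈)
    renaming (trans to <-trans; irrefl to <-irrefl; asym to <-asym)
  open NonStrict _≈_ _<_ public using (_≤_)

  _-_ : Op₂ Carrier
  x - y = x + - y

  _/_ : Op₂ Carrier
  x / y = x * y ⁻¹

  ∣_∣ : Op₁ Carrier
  ∣ x ∣ = if does (x <? 0#) then - x else x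

module Lipschitz {c ℓ₁ ℓ₂} (R : OrderedField c ℓ₁ ℓ₂) where
  open OrderedField R

  -- The set P is given by an enumeration p of its n elements, in no
  -- particular order and without repetition; the map on P is given by
  -- its values f i at the points p i.
  record Instance (n : ℕ) : Set (c ⊔ ℓ₁) where
    field
      p          : Vector Carrier n
      p-distinct : Injective _≡_ _≈_ p
      f          : Vector Carrier n

  module _ {n} (P : Instance n) where
    open Instance P

    IsLipschitzAt : Fin n → Carrier → Set (ℓ₁ ⊔ ℓ₂)
    IsLipschitzAt i K = ∀ j → ∣ f i - f j ∣ ≤ K * ∣ p i - p j ∣

    -- K is the smallest nonnegative number such that p i is K-Lipschitz.
    -- Nonnegativity matters only when p i is the sole point of P: every
    -- K is then a Lipschitz bound, and the constant is taken to be 0.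
    record IsLipschitzConstantAt (i : Fin n) (K : Carrier)
           : Set (c ⊔ ℓ₁ ⊔ ℓ₂) where
      field
        nonNegative : 0# ≤ K
        isLipschitz : IsLipschitzAt i K
        least       : ∀ K′ → 0# ≤ K′ → IsLipschitzAt i K′ → K ≤ K′

-- A real RAM has registers and indirectly addressed memory cells of two
-- sorts: indices (natural numbers) and reals.  Arguments of type ℕ
-- below are register numbers, except that of lit, which is a numeral.

data IndexExpr : Set where
  lit  : ℕ → IndexExpr
  reg  : ℕ → IndexExpr
  add  : ℕ → ℕ → IndexExpr
  sub  : ℕ → ℕ → IndexExpr
  half : ℕ → IndexExpr
  load : ℕ → IndexExpr

-- The argument of load is an index register, which holds the address.
data RealExpr : Set where
  zero one        : RealExpr
  reg             : ℕ → RealExpr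
  add sub mul div : ℕ → ℕ → RealExpr
  load            : ℕ → RealExpr

infix 5 _≔ᴵ_ _≔ᴿ_

-- storeᴵ a i and storeᴿ a x write index register i, resp. real
-- register x, to the memory cell whose address is in index register a.
data Instruction : Set where
  _≔ᴵ_          : ℕ → IndexExpr → Instruction
  _≔ᴿ_          : ℕ → RealExpr → Instruction
  storeᴵ storeᴿ : ℕ → ℕ → Instruction

data Test : Set where
  _<ᴵ_ _<ᴿ_ : ℕ → ℕ → Test

infixr 3 _⨾_

data Program : Set where
  skip  : Program
  instr : Instruction → Program
  _⨾_   : Program → Program → Program
  ifte  : Test → Program → Program → Program
  while : Test → Program → Program

infixl 9 _[_↦_]

_[_↦_] : ∀ {a} {A : Set a} → (ℕ → A) → ℕ → A → ℕ → A
(g [ k ↦ a ]) j = if j ≡ᵇ k then a else g j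

module RealRAM {c ℓ₁ ℓ₂} (R : OrderedField c ℓ₁ ℓ₂) where
  open OrderedField R

  record State : Set c where
    constructor ⟨_,_,_,_⟩
    field
      iReg : ℕ → ℕ
      rReg : ℕ → Carrier
      iMem : ℕ → ℕ
      rMem : ℕ → Carrier
  open State public

  evalᴵ : IndexExpr → State → ℕ
  evalᴵ (lit k)   s = k
  evalᴵ (reg i)   s = iReg s i
  evalᴵ (add i j) s = iReg s i ℕ.+ iReg s j
  evalᴵ (sub i j) s = iReg s i ℕ.∸ iReg s j
  evalᴵ (half i)  s = ⌊ iReg s i /2⌋
  evalᴵ (load a)  s = iMem s (iReg s a)

  evalᴿ : RealExpr → State → Carrier
  evalᴿ zero      s = 0#
  evalᴿ one       s = 1#
  evalᴿ (reg x)   s = rReg s x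
  evalᴿ (add x y) s = rReg s x + rReg s y
  evalᴿ (sub x y) s = rReg s x - rReg s y
  evalᴿ (mul x y) s = rReg s x * rReg s y
  evalᴿ (div x y) s = rReg s x / rReg s y
  evalᴿ (load a)  s = rMem s (iReg s a)

  exec : Instruction → State → State
  exec (i ≔ᴵ e)     s = record s { iReg = iReg s [ i ↦ evalᴵ e s ] }
  exec (x ≔ᴿ e)     s = record s { rReg = rReg s [ x ↦ evalᴿ e s ] }
  exec (storeᴵ a i) s = record s { iMem = iMem s [ iReg s a ↦ iReg s i ] }
  exec (storeᴿ a x) s = record s { rMem = rMem s [ iReg s a ↦ rReg s x ] }

  -- A division by zero is not enabled: the machine gets stuck.
  Enabled : Instruction → State → Set ℓ₁
  Enabled (_ ≔ᴿ div x y) s = rReg s y ≉ 0#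
  Enabled _              s = ⊤

  holds : Test → State → Bool
  holds (i <ᴵ j) s = does (iReg s i ℕ.<? iReg s j)
  holds (x <ᴿ y) s = does (rReg s x <? rReg s y)

  -- ⟪ P , s ⟫⇓[ t ] s′: started in state s, P halts in state s′ after t
  -- units of time, one for each instruction executed and each test made.
  data ⟪_,_⟫⇓[_]_ : Program → State → ℕ → State → Set (c ⊔ ℓ₁) where
    skip       : ∀ {s} → ⟪ skip , s ⟫⇓[ 0 ] s
    instr      : ∀ {s I} → Enabled I s → ⟪ instr I , s ⟫⇓[ 1 ] exec I s
    seq        : ∀ {P Q s s′ s″ t u} →
                 ⟪ P , s ⟫⇓[ t ] s′ → ⟪ Q , s′ ⟫⇓[ u ] s″ →
                 ⟪ P ⨾ Q , s ⟫⇓[ t ℕ.+ u ] s″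
    if-true    : ∀ {B P Q s s′ t} → holds B s ≡ true →
                 ⟪ P , s ⟫⇓[ t ] s′ →
                 ⟪ ifte B P Q , s ⟫⇓[ suc t ] s′
    if-false   : ∀ {B P Q s s′ t} → holds B s ≡ false →
                 ⟪ Q , s ⟫⇓[ t ] s′ →
                 ⟪ ifte B P Q , s ⟫⇓[ suc t ] s′
    while-true : ∀ {B P s s′ s″ t u} → holds B s ≡ true →
                 ⟪ P , s ⟫⇓[ t ] s′ → ⟪ while B P , s′ ⟫⇓[ u ] s″ →
                 ⟪ while B P , s ⟫⇓[ suc (t ℕ.+ u) ] s″
    while-false : ∀ {B P s} → holds B s ≡ false →
                  ⟪ while B P , s ⟫⇓[ 1 ] s

  array : ∀ {m} → Vector Carrier m → ℕ → Carrier
  array {m} v k with k ℕ.<? m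
  ... | yes k<m = v (fromℕ< k<m)
  ... | no  _   = 0#

  open Lipschitz R

  -- Index register 0 holds n; p occupies the real memory cells 0, …, n-1
  -- and f the cells n, …, 2n-1.  Everything else is 0.
  input : ∀ {n} → Instance n → State
  input {n} P =
    ⟨ (λ _ → 0) [ 0 ↦ n ] , (λ _ → 0#) , (λ _ → 0) , array (p ++ f) ⟩
    where open Instance P

  -- The answer is read off the real memory cells 2n, …, 3n-1.
  output : State → (n : ℕ) → Vector Carrier n
  output s n i = rMem s (n ℕ.+ n ℕ.+ toℕ i)

  ComputesLipschitzConstantsInTime : Program → (ℕ → ℕ) → Set (c ⊔ ℓ₁ ⊔ ℓ₂)
  ComputesLipschitzConstantsInTime A T =
    ∀ {n} (P : Instance n) → ∃₂ λ t s →
      ⟪ A , input P ⟫⇓[ t ] s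
      × t ℕ.≤ T n
      × (∀ i → IsLipschitzConstantAt P i (output s n i))

{-# OPTIONS --safe #-}

-- Sort the points with a tournament tree and scan them from left to right.
-- For the k-th point let parent k < k be the point seen from it under the
-- largest slope. For a new point q, start at i = q-1 and replace i by
-- parent i as long as that increases the slope to q. The chain of parents is
-- the lower hull of the points seen so far, so the point reached is parent q.
-- Each replacement shortens the chain by one and each new point lengthens it
-- by one, so the scan takes linear time. Running sort and scan on the four
-- sets (±p, ±f) covers the slopes of either sign to points on either side.
-- In all this takes O(n log n) steps.

module Submission where

open import Defs
open import Algebra.Bundles using (CommutativeRing)
open import Algebra.Solver.Ring.AlmostCommutativeRing using (_-Raw-AlmostCommutative⟶_; fromCommutativeRing)
open import Data.Bool.Base using (true; false)
open import Data.Empty using (⊥-elim)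
open import Data.Fin.Base using (Fin; toℕ; fromℕ<; _↑ˡ_; _↑ʳ_)
import Data.Fin.Properties as Fin
open import Data.Integer.Base as ℤ using (ℤ; +_; -[1+_]; _⊖_)
import Data.Integer.Properties as ℤ
open import Data.List.Base using (List; []; _∷_; foldr; length)
open import Data.Maybe.Base using (Maybe; map)
open import Data.Nat.Base as ℕ using (ℕ; zero; suc; z≤n; s≤s; ⌊_/2⌋; _≡ᵇ_)
open import Data.Nat.Induction using (<-rec)
open import Data.Nat.Logarithm using (⌊log₂_⌋; ⌊log₂⌋-mono-≤; ⌊log₂⌊n/2⌋⌋≡⌊log₂n⌋∸1; ⌊log₂[2*b]⌋≡1+⌊log₂b⌋)
import Data.Nat.Properties as ℕ
open import Data.Nat.Tactic.RingSolver using (solve-∀)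
open import Data.Product.Base using (_×_; _,_; proj₁; proj₂; ∃-syntax; ∃₂; map₂)
open import Data.Sign.Base using (Sign)
open import Data.Sum.Base using (_⊎_; inj₁; inj₂)
open import Data.Unit.Polymorphic.Base using (⊤)
open import Data.Vec.Functional using (Vector; _++_)
open import Data.Vec.Functional.Properties using (lookup-++ˡ; lookup-++ʳ)
open import Level using (_⊔_)
open import Relation.Binary.Bundles using (StrictTotalOrder)
open import Relation.Binary.Consequences using (dec⇒weaklyDec)
open import Relation.Binary.Definitions using (tri<; tri≈; tri>)
open import Relation.Binary.PropositionalEquality.Core as ≡ using (_≡_)
open import Relation.Nullary.Decidable.Core using (Dec; does; yes; no)
open import Relation.Nullary.Negation.Core using (¬_; contradiction)

-- Comparing i with `parent i` alone settles the search, because adding i recorded that every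
-- earlier point lies on or above the line through i and its parent. If q sees i at least as steeply
-- as the parent, that line is no steeper than the chord from i to q, so nothing further left can
-- win. Otherwise the points between the parent and i lie on or above the chord from the parent to
-- q, and they need no further attention.
--
-- The linear bound comes from the potential 2(n - q) + depth i, where depth is the length of the
-- chain of parents. Moving to the parent lowers the depth by one; finishing q releases two and adds
-- one level.
--
-- A quotient |f x - f y| / |x - y| is a nonnegative slope after a suitable reflection of each axis,
-- so all passes raise the same answer cell, which starts at 0. Bounds on slopes are stated as
-- linear inequalities without division; these compose along paths of points. Quotients occur only
-- where the machine divides, and there the sorted order makes the denominator nonzero.

-- Arithmetic, order and absolute value in an ordered field.

module OrderedFieldProperties {c ℓ₁ ℓ₂} (R : OrderedField c ℓ₁ ℓ₂) where
  open OrderedField R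

  commutativeRing : CommutativeRing c ℓ₁
  commutativeRing = record { isCommutativeRing = isCommutativeRing }

  open import Algebra.Properties.Ring (CommutativeRing.ring commutativeRing)
    using (-‿involutive; -‿distribˡ-*; -‿distribʳ-*; -‿+-comm; -0#≈0#)
  open import Algebra.Properties.Semiring.Mult (CommutativeRing.semiring commutativeRing)
    using (×-homo-+; ×1-homo-*) renaming (_×_ to _×ₙ_)
  open import Relation.Binary.Reasoning.Setoid (CommutativeRing.setoid commutativeRing)

  -- The ring solver needs coefficients whose equality computes.
  ⟦_⟧ℤ : ℤ → Carrier
  ⟦ + n      ⟧ℤ = n ×ₙ 1#
  ⟦ -[1+ n ] ⟧ℤ = - (suc n ×ₙ 1#)

  1+x-1+y : ∀ x y → (1# + x) - (1# + y) ≈ x - y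
  1+x-1+y x y = begin
    (1# + x) - (1# + y)       ≈⟨ +-congˡ (-‿+-comm 1# y) ⟨
    (1# + x) + (- 1# + - y)   ≈⟨ +-congʳ (+-comm 1# x) ⟩
    (x + 1#) + (- 1# + - y)   ≈⟨ +-assoc x 1# _ ⟩
    x + (1# + (- 1# + - y))   ≈⟨ +-congˡ (+-assoc 1# _ _) ⟨
    x + ((1# + - 1#) + - y)   ≈⟨ +-congˡ (+-congʳ (-‿inverseʳ 1#)) ⟩
    x + (0# + - y)            ≈⟨ +-congˡ (+-identityˡ _) ⟩
    x - y                     ∎

  ⟦⊖⟧ℤ : ∀ m n → ⟦ m ⊖ n ⟧ℤ ≈ m ×ₙ 1# - n ×ₙ 1#
  ⟦⊖⟧ℤ m zero = begin
    m ×ₙ 1#         ≈⟨ +-identityʳ _ ⟨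
    m ×ₙ 1# + 0#    ≈⟨ +-congˡ -0#≈0# ⟨
    m ×ₙ 1# - 0#    ∎
  ⟦⊖⟧ℤ zero (suc n) = sym (+-identityˡ _)
  ⟦⊖⟧ℤ (suc m) (suc n) rewrite ℤ.[1+m]⊖[1+n]≡m⊖n m n =
    trans (⟦⊖⟧ℤ m n) (sym (1+x-1+y _ _))

  ⟦+⟧ℤ : ∀ i j → ⟦ i ℤ.+ j ⟧ℤ ≈ ⟦ i ⟧ℤ + ⟦ j ⟧ℤ
  ⟦+⟧ℤ (+ m) (+ n) = ×-homo-+ 1# m n
  ⟦+⟧ℤ (+ m) -[1+ n ] = ⟦⊖⟧ℤ m (suc n)
  ⟦+⟧ℤ -[1+ m ] (+ n) = trans (⟦⊖⟧ℤ n (suc m)) (+-comm _ _)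
  ⟦+⟧ℤ -[1+ m ] -[1+ n ] = begin
    - (suc (suc (m ℕ.+ n)) ×ₙ 1#)         ≈⟨ -‿cong (+-congˡ (×-homo-+ 1# (suc m) n)) ⟩
    - (1# + (suc m ×ₙ 1# + n ×ₙ 1#))      ≈⟨ -‿cong (+-assoc _ _ _) ⟨
    - (1# + suc m ×ₙ 1# + n ×ₙ 1#)        ≈⟨ -‿cong (+-congʳ (+-comm _ _)) ⟩
    - (suc m ×ₙ 1# + 1# + n ×ₙ 1#)        ≈⟨ -‿cong (+-assoc _ _ _) ⟩
    - (suc m ×ₙ 1# + suc n ×ₙ 1#)         ≈⟨ -‿+-comm _ _ ⟨
    - (suc m ×ₙ 1#) + - (suc n ×ₙ 1#)     ∎

  ⟦-⟧ℤ : ∀ i → ⟦ ℤ.- i ⟧ℤ ≈ - ⟦ i ⟧ℤ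
  ⟦-⟧ℤ (+ zero)   = sym -0#≈0#
  ⟦-⟧ℤ (+ suc n)  = refl
  ⟦-⟧ℤ -[1+ n ]   = sym (-‿involutive _)

  ⟦*⟧ℤ : ∀ i j → ⟦ i ℤ.* j ⟧ℤ ≈ ⟦ i ⟧ℤ * ⟦ j ⟧ℤ
  ⟦*⟧ℤ (+ m) (+ n) rewrite ≡.sym (ℤ.pos-* m n) = ×1-homo-* m n
  ⟦*⟧ℤ (+ m) -[1+ n ] rewrite ≡.sym (ℤ.neg-distribʳ-* (+ m) (+ suc n)) =
    trans (⟦-⟧ℤ (+ m ℤ.* + suc n))
      (trans (-‿cong (⟦*⟧ℤ (+ m) (+ suc n))) (-‿distribʳ-* _ _))
  ⟦*⟧ℤ -[1+ m ] (+ n) rewrite ≡.sym (ℤ.neg-distribˡ-* (+ suc m) (+ n)) =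
    trans (⟦-⟧ℤ (+ suc m ℤ.* + n))
      (trans (-‿cong (⟦*⟧ℤ (+ suc m) (+ n))) (-‿distribˡ-* _ _))
  ⟦*⟧ℤ -[1+ m ] -[1+ n ] = begin
    (suc m ℕ.* suc n) ×ₙ 1#               ≈⟨ ×1-homo-* (suc m) (suc n) ⟩
    (suc m ×ₙ 1#) * (suc n ×ₙ 1#)         ≈⟨ -‿involutive _ ⟨
    - - ((suc m ×ₙ 1#) * (suc n ×ₙ 1#))   ≈⟨ -‿cong (-‿distribˡ-* _ _) ⟩
    - (- (suc m ×ₙ 1#) * (suc n ×ₙ 1#))   ≈⟨ -‿distribʳ-* _ _ ⟩
    - (suc m ×ₙ 1#) * - (suc n ×ₙ 1#)     ∎

  ℤ-morphism : ℤ.+-*-rawRing -Raw-AlmostCommutative⟶ fromCommutativeRing commutativeRing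
  ℤ-morphism = record
    { ⟦_⟧    = ⟦_⟧ℤ
    ; +-homo = ⟦+⟧ℤ
    ; *-homo = ⟦*⟧ℤ
    ; -‿homo = ⟦-⟧ℤ
    ; 0-homo = refl
    ; 1-homo = +-identityʳ 1#
    }

  ⟦⟧ℤ-≟ : ∀ i j → Maybe (⟦ i ⟧ℤ ≈ ⟦ j ⟧ℤ)
  ⟦⟧ℤ-≟ i j = map (λ { ≡.refl → refl }) (dec⇒weaklyDec ℤ._≟_ i j)

  open import Algebra.Solver.Ring ℤ.+-*-rawRing (fromCommutativeRing commutativeRing) ℤ-morphism
    ⟦⟧ℤ-≟ public
    using (solve; _:=_; _:+_; _:-_; _:*_; :-_)

  strictTotalOrder : StrictTotalOrder c ℓ₁ ℓ₂
  strictTotalOrder = record { isStrictTotalOrder = isStrictTotalOrder }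

  open import Relation.Binary.Properties.StrictTotalOrder strictTotalOrder public
    using () renaming (refl to ≤-refl; trans to ≤-trans; reflexive to ≤-reflexive; total to ≤-total)

  <-irreflexive : ∀ {x} → ¬ x < x
  <-irreflexive = <-irrefl refl

  <⇒≤ : ∀ {x y} → x < y → x ≤ y
  <⇒≤ = inj₁

  ≮⇒≥ : ∀ {x y} → ¬ (x < y) → y ≤ x
  ≮⇒≥ {x} {y} x≮y with compare x y
  ... | tri< x<y _ _ = contradiction x<y x≮y
  ... | tri≈ _ x≈y _ = inj₂ (sym x≈y)
  ... | tri> _ _ y<x = inj₁ y<x

  ≤⇒≯ : ∀ {x y} → x ≤ y → ¬ (y < x)
  ≤⇒≯ (inj₁ x<y) y<x = <-asym x<y y<x
  ≤⇒≯ (inj₂ x≈y) y<x = <-irrefl (sym x≈y) y<x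

  ≤-resp : ∀ {x x′ y y′} → x ≈ x′ → y ≈ y′ → x ≤ y → x′ ≤ y′
  ≤-resp x≈x′ y≈y′ x≤y = ≤-trans (≤-reflexive (sym x≈x′)) (≤-trans x≤y (≤-reflexive y≈y′))

  <-resp : ∀ {x x′ y y′} → x ≈ x′ → y ≈ y′ → x < y → x′ < y′
  <-resp x≈x′ y≈y′ x<y = proj₂ <-resp-≈ x≈x′ (proj₁ <-resp-≈ y≈y′ x<y)

  +-mono-≤ : ∀ {w x y z} → w ≤ x → y ≤ z → w + y ≤ x + z
  +-mono-≤ w≤x y≤z = ≤-trans (left w≤x) (right y≤z)
    where
    right : ∀ {x y z} → y ≤ z → x + y ≤ x + z
    right (inj₁ y<z) = inj₁ (+-monoʳ-< _ y<z)
    right (inj₂ y≈z) = inj₂ (+-congˡ y≈z)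
    left : ∀ {x y z} → x ≤ y → x + z ≤ y + z
    left x≤y = ≤-resp (+-comm _ _) (+-comm _ _) (right x≤y)

  x<y⇒0<y-x : ∀ {x y} → x < y → 0# < y - x
  x<y⇒0<y-x {x} {y} x<y = <-resp (-‿inverseˡ x) (+-comm (- x) y) (+-monoʳ-< (- x) x<y)

  x≤y⇒0≤y-x : ∀ {x y} → x ≤ y → 0# ≤ y - x
  x≤y⇒0≤y-x (inj₁ x<y) = inj₁ (x<y⇒0<y-x x<y)
  x≤y⇒0≤y-x (inj₂ x≈y) = inj₂ (sym (trans (+-congʳ (sym x≈y)) (-‿inverseʳ _)))

  0≤y-x⇒x≤y : ∀ {x y} → 0# ≤ y - x → x ≤ y
  0≤y-x⇒x≤y {x} {y} 0≤y-x =
    ≤-resp (+-identityʳ x) (solve 2 (λ x y → x :+ (y :- x) := y) refl x y) (+-mono-≤ (≤-refl {x}) 0≤y-x)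

  *-nonNeg : ∀ {x y} → 0# ≤ x → 0# ≤ y → 0# ≤ x * y
  *-nonNeg (inj₁ 0<x) (inj₁ 0<y) = inj₁ (*-pos 0<x 0<y)
  *-nonNeg {x} (inj₁ _) (inj₂ 0≈y) = inj₂ (trans (sym (zeroʳ x)) (*-congˡ 0≈y))
  *-nonNeg {_} {y} (inj₂ 0≈x) _ = inj₂ (trans (sym (zeroˡ y)) (*-congʳ 0≈x))

  *-monoʳ-≤ : ∀ {x y z} → 0# ≤ z → x ≤ y → x * z ≤ y * z
  *-monoʳ-≤ {x} {y} {z} 0≤z x≤y = 0≤y-x⇒x≤y
    (≤-resp refl (solve 3 (λ x y z → (y :- x) :* z := y :* z :- x :* z) refl x y z)
      (*-nonNeg (x≤y⇒0≤y-x x≤y) 0≤z))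

  *-cancelʳ-≤ : ∀ {x y z} → 0# < z → x * z ≤ y * z → x ≤ y
  *-cancelʳ-≤ {x} {y} {z} 0<z xz≤yz = ≮⇒≥ λ y<x →
    ≤⇒≯ xz≤yz (0<y-x⇒x<y (<-resp refl (solve 3 (λ x y z → (x :- y) :* z := x :* z :- y :* z) refl x y z)
      (*-pos (x<y⇒0<y-x y<x) 0<z)))
    where
    0<y-x⇒x<y : ∀ {x y} → 0# < y - x → x < y
    0<y-x⇒x<y {x} {y} 0<y-x =
      <-resp (+-identityʳ x) (solve 2 (λ x y → x :+ (y :- x) := y) refl x y) (+-monoʳ-< x 0<y-x)

  x<y⇒y-x≉0 : ∀ {x y} → x < y → y - x ≉ 0#
  x<y⇒y-x≉0 x<y y-x≈0 = <-irrefl (sym y-x≈0) (x<y⇒0<y-x x<y)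

  x≤0⇒0≤-x : ∀ {x} → x ≤ 0# → 0# ≤ - x
  x≤0⇒0≤-x x≤0 = ≤-resp refl (+-identityˡ _) (x≤y⇒0≤y-x x≤0)

  neg-< : ∀ {x y} → x < y → - y < - x
  neg-< {x} {y} x<y = <-resp
    (solve 2 (λ x y → (:- x :- y) :+ x := :- y) refl x y) (solve 2 (λ x y → (:- x :- y) :+ y := :- x) refl x y)
    (+-monoʳ-< (- x - y) x<y)

  IsSign : Carrier → Set ℓ₁
  IsSign ε = ε ≈ 1# ⊎ ε ≈ - 1#

  ∣x∣≥0 : ∀ x → 0# ≤ ∣ x ∣
  ∣x∣≥0 x with x <? 0#
  ... | yes x<0 = x≤0⇒0≤-x (inj₁ x<0)
  ... | no x≮0 = ≮⇒≥ x≮0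

  x≤∣x∣ : ∀ x → x ≤ ∣ x ∣
  x≤∣x∣ x with x <? 0#
  ... | yes x<0 = ≤-trans (inj₁ x<0) (x≤0⇒0≤-x (inj₁ x<0))
  ... | no _ = ≤-refl

  -x≤∣x∣ : ∀ x → - x ≤ ∣ x ∣
  -x≤∣x∣ x with x <? 0#
  ... | yes x<0 = ≤-refl
  ... | no x≮0 = ≤-trans (≤-resp (+-identityˡ _) (-‿inverseʳ x) (+-mono-≤ (≮⇒≥ x≮0) (≤-refl { - x}))) (≮⇒≥ x≮0)

  sign*≈ : ∀ {ε} → IsSign ε → ∀ x → ε * x ≈ x ⊎ ε * x ≈ - x
  sign*≈ (inj₁ ε≈1) x = inj₁ (trans (*-congʳ ε≈1) (*-identityˡ x))
  sign*≈ (inj₂ ε≈-1) x = inj₂ (trans (*-congʳ ε≈-1) (trans (sym (-‿distribˡ-* _ _)) (-‿cong (*-identityˡ x))))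

  sign*≤∣∣ : ∀ {ε} → IsSign ε → ∀ x → ε * x ≤ ∣ x ∣
  sign*≤∣∣ sε x with sign*≈ sε x
  ... | inj₁ εx≈x = ≤-resp (sym εx≈x) refl (x≤∣x∣ x)
  ... | inj₂ εx≈-x = ≤-resp (sym εx≈-x) refl (-x≤∣x∣ x)

  -- The sign need not be the one by which `∣_∣` is computed: at x ≈ 0 both signs qualify, and the
  -- last case below is exactly that one.
  ∣∣-pos : ∀ {ε} → IsSign ε → ∀ x → 0# ≤ ε * x → ∣ x ∣ ≤ ε * x
  ∣∣-pos sε x 0≤εx with sign*≈ sε x | x <? 0#
  ... | inj₁ εx≈x | yes x<0 = contradiction x<0 (≤⇒≯ (≤-resp refl εx≈x 0≤εx))
  ... | inj₁ εx≈x | no _ = ≤-reflexive (sym εx≈x)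
  ... | inj₂ εx≈-x | yes _ = ≤-reflexive (sym εx≈-x)
  ... | inj₂ εx≈-x | no x≮0 = ≤-trans
    (0≤y-x⇒x≤y (≤-resp refl (trans εx≈-x (sym (+-identityˡ _))) 0≤εx))
    0≤εx

  -- Slopes of chords.

  module Slopes (X Y : ℕ → Carrier) where

    -- No order between X i and X j is presupposed. For j to the right of i this bounds the slope of
    -- the chord above by K, for j to the left it bounds it below. Hence bounds with the same K add
    -- up along any path, in either direction.
    Below : Carrier → ℕ → ℕ → Set (ℓ₁ ⊔ ℓ₂)
    Below K i j = Y j - Y i ≤ K * (X j - X i)

    slope : ℕ → ℕ → Carrier
    slope i j = (Y j - Y i) / (X j - X i)

    Below-trans : ∀ {K i j k} → Below K i j → Below K j k → Below K i k
    Below-trans {K} {i} {j} {k} ij jk = ≤-resp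
      (solve 3 (λ x y z → (y :- x) :+ (z :- y) := z :- x) refl (Y i) (Y j) (Y k))
      (solve 4 (λ K x y z → K :* (y :- x) :+ K :* (z :- y) := K :* (z :- x)) refl K (X i) (X j) (X k))
      (+-mono-≤ ij jk)

    Below-weaken : ∀ {K K′ i j} → K ≤ K′ → X i < X j → Below K i j → Below K′ i j
    Below-weaken K≤K′ i<j below = ≤-trans below (*-monoʳ-≤ (<⇒≤ (x<y⇒0<y-x i<j)) K≤K′)

    Below-weaken-backwards : ∀ {K K′ i j} → K′ ≤ K → X j < X i → Below K i j → Below K′ i j
    Below-weaken-backwards {K} {K′} {i} {j} K′≤K j<i below = ≤-trans below (0≤y-x⇒x≤y (≤-resp refl
      (solve 4 (λ K K′ x y → (K :- K′) :* (x :- y) := K′ :* (y :- x) :- K :* (y :- x)) refl K K′ (X i) (X j))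
      (*-nonNeg (x≤y⇒0≤y-x K′≤K) (<⇒≤ (x<y⇒0<y-x j<i)))))

    module _ {i j} (i<j : X i < X j) where

      slope-exact : slope i j * (X j - X i) ≈ Y j - Y i
      slope-exact = begin
        (Y j - Y i) * (X j - X i) ⁻¹ * (X j - X i)     ≈⟨ *-assoc _ _ _ ⟩
        (Y j - Y i) * ((X j - X i) ⁻¹ * (X j - X i))   ≈⟨ *-congˡ (*-comm _ _) ⟩
        (Y j - Y i) * ((X j - X i) * (X j - X i) ⁻¹)   ≈⟨ *-congˡ (⁻¹-inverseʳ _ (x<y⇒y-x≉0 i<j)) ⟩
        (Y j - Y i) * 1#                               ≈⟨ *-identityʳ _ ⟩
        Y j - Y i                                      ∎

      Below-slope : Below (slope i j) i j
      Below-slope = ≤-reflexive (sym slope-exact)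

      Below-slope-backwards : Below (slope i j) j i
      Below-slope-backwards = ≤-reflexive (begin
        Y i - Y j                      ≈⟨ solve 2 (λ x y → x :- y := :- (y :- x)) refl (Y i) (Y j) ⟩
        - (Y j - Y i)                  ≈⟨ -‿cong slope-exact ⟨
        - (slope i j * (X j - X i))    ≈⟨ solve 3 (λ K x y → :- (K :* (y :- x)) := K :* (x :- y)) refl (slope i j) (X i) (X j) ⟩
        slope i j * (X i - X j)        ∎)

      slope-least : ∀ {K} → Below K i j → slope i j ≤ K
      slope-least below = *-cancelʳ-≤ (x<y⇒0<y-x i<j) (≤-resp (sym slope-exact) refl below)

      slope-greatest : ∀ {K} → Below K j i → K ≤ slope i j
      slope-greatest {K} below = *-cancelʳ-≤ (x<y⇒0<y-x i<j) (≤-resp refl (sym slope-exact)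
        (0≤y-x⇒x≤y (≤-resp refl
          (solve 5 (λ K x y u v → K :* (x :- y) :- (u :- v) := v :- u :- K :* (y :- x)) refl K (X i) (X j) (Y i) (Y j))
          (x≤y⇒0≤y-x below))))

    -- Against j, the slopes K = slope i k ≥ slope j k and e = slope i j:
    -- a point l between i and j lies above the chord ij, hence above ik.
    Below-pop : ∀ {i j k} → X i < X j → X j < X k → slope j k ≤ slope i k →
                ∀ {l} → X i < X l → Below (slope i j) l j → Below (slope i k) l k
    Below-pop i<j j<k jk≤ik i<l lj = Below-trans
      (Below-weaken-backwards (slope-greatest i<j (Below-trans (Below-weaken jk≤ik j<k (Below-slope j<k)) (Below-slope-backwards i<k)))
        i<l (Below-trans lj (Below-slope-backwards i<j)))
      (Below-slope i<k)
      where i<k = <-trans i<j j<k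

    -- The slope of ik is a mean of those of ij and jk, so if jk is at least as steep as ik, it is
    -- at least as steep as ij. The line through j with the slope of ij passes on or below l; to the
    -- left of j the steeper line through j and k is lower still.
    Below-stop : ∀ {i j k} → X i < X j → X j < X k → slope i k ≤ slope j k →
                 ∀ {l} → X l < X j → Below (slope i j) l j → Below (slope j k) l k
    Below-stop i<j j<k ik≤jk l<j lj = Below-trans
      (Below-weaken (slope-least i<j (Below-trans (Below-weaken ik≤jk i<k (Below-slope i<k)) (Below-slope-backwards j<k)))
        l<j lj)
      (Below-slope j<k)
      where i<k = <-trans i<j j<k

-- Function update and halving.

open ≡ using (_≢_; refl; sym; trans; cong; cong₂; subst; subst₂)

≡ᵇ-refl : ∀ k → (k ≡ᵇ k) ≡ true
≡ᵇ-refl zero = refl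
≡ᵇ-refl (suc k) = ≡ᵇ-refl k

≢⇒≡ᵇ-false : ∀ {j k} → j ≢ k → (j ≡ᵇ k) ≡ false
≢⇒≡ᵇ-false {zero} {zero} j≢k = contradiction refl j≢k
≢⇒≡ᵇ-false {zero} {suc k} j≢k = refl
≢⇒≡ᵇ-false {suc j} {zero} j≢k = refl
≢⇒≡ᵇ-false {suc j} {suc k} j≢k = ≢⇒≡ᵇ-false (λ j≡k → j≢k (cong suc j≡k))

module _ {a} {A : Set a} (g : ℕ → A) where

  ↦-same : ∀ k {x} → (g [ k ↦ x ]) k ≡ x
  ↦-same k rewrite ≡ᵇ-refl k = refl

  ↦-other : ∀ {j k x} → j ≢ k → (g [ k ↦ x ]) j ≡ g j
  ↦-other j≢k rewrite ≢⇒≡ᵇ-false j≢k = refl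

  ↦-same′ : ∀ {j k x} → j ≡ k → (g [ k ↦ x ]) j ≡ x
  ↦-same′ {k = k} refl = ↦-same k

halves : ∀ u → u ≡ ⌊ u /2⌋ ℕ.+ ⌊ u /2⌋ ⊎ u ≡ ⌊ u /2⌋ ℕ.+ ⌊ u /2⌋ ℕ.+ 1
halves 0 = inj₁ refl
halves 1 = inj₂ refl
halves (suc (suc u)) rewrite ℕ.+-suc ⌊ u /2⌋ ⌊ u /2⌋ with halves u
... | inj₁ eq = inj₁ (cong (λ v → suc (suc v)) eq)
... | inj₂ eq = inj₂ (cong (λ v → suc (suc v)) eq)

⌊n+n/2⌋ : ∀ n → ⌊ n ℕ.+ n /2⌋ ≡ n
⌊n+n/2⌋ zero = refl
⌊n+n/2⌋ (suc n) rewrite ℕ.+-suc n n = cong suc (⌊n+n/2⌋ n)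

⌊n+n+1/2⌋ : ∀ n → ⌊ n ℕ.+ n ℕ.+ 1 /2⌋ ≡ n
⌊n+n+1/2⌋ zero = refl
⌊n+n+1/2⌋ (suc n) rewrite ℕ.+-suc n n = cong suc (⌊n+n+1/2⌋ n)

⌊/2⌋+⌊/2⌋≤ : ∀ u → ⌊ u /2⌋ ℕ.+ ⌊ u /2⌋ ℕ.≤ u
⌊/2⌋+⌊/2⌋≤ u with halves u
... | inj₁ eq = ℕ.≤-reflexive (sym eq)
... | inj₂ eq = ℕ.≤-trans (ℕ.m≤m+n _ 1) (ℕ.≤-reflexive (sym eq))

⌊/2⌋-< : ∀ {u n} → u ℕ.< n ℕ.+ n → ⌊ u /2⌋ ℕ.< n
⌊/2⌋-< {u} u<2n = ℕ.≰⇒> λ n≤⌊u/2⌋ →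
  ℕ.<-irrefl refl (ℕ.<-≤-trans u<2n (ℕ.≤-trans (ℕ.+-mono-≤ n≤⌊u/2⌋ n≤⌊u/2⌋) (⌊/2⌋+⌊/2⌋≤ u)))

1≤⌊/2⌋ : ∀ {u} → 1 ℕ.< u → 1 ℕ.≤ ⌊ u /2⌋
1≤⌊/2⌋ {suc (suc u)} _ = s≤s z≤n
1≤⌊/2⌋ {suc zero} (s≤s ())

⌊/2⌋<u : ∀ {u} → 1 ℕ.≤ u → ⌊ u /2⌋ ℕ.< u
⌊/2⌋<u {suc u} _ = ℕ.⌊n/2⌋<n u

m<n⇒m+m+1<n+n : ∀ {m n} → m ℕ.< n → m ℕ.+ m ℕ.+ 1 ℕ.< n ℕ.+ n
m<n⇒m+m+1<n+n {m} {n} m<n = subst (ℕ._≤ n ℕ.+ n)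
  (trans (ℕ.+-suc (suc m) m) (cong suc (ℕ.+-comm 1 (m ℕ.+ m)))) (ℕ.+-mono-≤ m<n m<n)

m<n⇒m+m<n+n : ∀ {m n} → m ℕ.< n → m ℕ.+ m ℕ.< n ℕ.+ n
m<n⇒m+m<n+n m<n = ℕ.+-mono-< m<n m<n

1≤m⇒m≢m+m : ∀ {m} → 1 ℕ.≤ m → m ≢ m ℕ.+ m
1≤m⇒m≢m+m 1≤m = ℕ.<⇒≢ (ℕ.m<m+n _ 1≤m)

m≢m+m+1 : ∀ m → m ≢ m ℕ.+ m ℕ.+ 1
m≢m+m+1 m = ℕ.<⇒≢ (ℕ.≤-<-trans (ℕ.m≤m+n m m) (ℕ.m<m+n _ (s≤s z≤n)))

-- Tournament trees.

module TournamentTree {c ℓ₁ ℓ₂} (R : OrderedField c ℓ₁ ℓ₂)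
                      (n : ℕ) (P : ℕ → OrderedField.Carrier R) where
  open OrderedField R using (_<_)
  open OrderedFieldProperties R using (≤-trans; ≮⇒≥; ≤⇒≯; <-irreflexive)

  -- The contestants are the indices below n; n itself marks a place whose
  -- contestant has left, and loses to everyone.
  _⊑_ : ℕ → ℕ → Set ℓ₂
  a ⊑ b = b ℕ.< n → a ℕ.< n × ¬ P b < P a

  ⊑-refl : ∀ {a} → a ⊑ a
  ⊑-refl a<n = a<n , <-irreflexive

  ⊑-trans : ∀ {a b c} → a ⊑ b → b ⊑ c → a ⊑ c
  ⊑-trans a⊑b b⊑c c<n with b⊑c c<n
  ... | b<n , c≮b with a⊑b b<n
  ... | a<n , b≮a = a<n , ≤⇒≯ (≤-trans (≮⇒≥ b≮a) (≮⇒≥ c≮b))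

  ⊑-last : ∀ {a b} → n ℕ.≤ b → a ⊑ b
  ⊑-last n≤b b<n = contradiction b<n (ℕ.≤⇒≯ n≤b)

  Winner : ℕ → ℕ → ℕ → Set ℓ₂
  Winner w a b = (w ≡ a ⊎ w ≡ b) × w ⊑ a × w ⊑ b

  record NodeOK (mem : ℕ → ℕ) (w : ℕ) : Set ℓ₂ where
    constructor nodeOK
    field winner : Winner (mem w) (mem (w ℕ.+ w)) (mem (w ℕ.+ w ℕ.+ 1))
  open NodeOK

  -- Node w has children 2w and 2w+1; the leaves are n, …, 2n-1 and the
  -- root is 1.  The sorted sequence out is collected in the cells from 2n on.
  -- Writing to a node v can only spoil its parent ⌊v/2⌋, the next hole; a
  -- hole of 0 stands for no hole.
  record Tree (leaf out mem : ℕ → ℕ) (hole : ℕ) : Set ℓ₂ where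
    field
      nodes  : ∀ {w} → 1 ℕ.≤ w → w ℕ.< n → w ≢ hole → NodeOK mem w
      leaves : ∀ {j} → j ℕ.< n → mem (n ℕ.+ j) ≡ leaf j
      outs   : ∀ k → mem (n ℕ.+ n ℕ.+ k) ≡ out k
  open Tree public

  module _ {leaf out mem : ℕ → ℕ} where

    -- Climb from u through its ancestors. The hole 0 is not a node, so every match on the way is
    -- valid.
    root-wins : Tree leaf out mem 0 → ∀ {u} → 1 ℕ.≤ u → u ℕ.< n ℕ.+ n → mem 1 ⊑ mem u
    root-wins T {u} = <-rec (λ u → 1 ℕ.≤ u → u ℕ.< n ℕ.+ n → mem 1 ⊑ mem u) step u
      where
      step : ∀ u → (∀ {v} → v ℕ.< u → 1 ℕ.≤ v → v ℕ.< n ℕ.+ n → mem 1 ⊑ mem v) →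
             1 ℕ.≤ u → u ℕ.< n ℕ.+ n → mem 1 ⊑ mem u
      step 1 _ _ _ = ⊑-refl
      step u@(suc (suc _)) ih 1≤u u<2n = ⊑-trans (ih (⌊/2⌋<u 1≤u) 1≤v (ℕ.<-≤-trans v<n (ℕ.m≤m+n n n))) v⊑u
        where
        v = ⌊ u /2⌋
        1≤v : 1 ℕ.≤ v
        1≤v = s≤s z≤n
        v<n : v ℕ.< n
        v<n = ⌊/2⌋-< u<2n
        v⊑u : mem v ⊑ mem u
        v⊑u with halves u
        ... | inj₁ eq = subst (λ x → mem v ⊑ mem x) (sym eq) (proj₁ (proj₂ (winner (nodes T 1≤v v<n (λ ())))))
        ... | inj₂ eq = subst (λ x → mem v ⊑ mem x) (sym eq) (proj₂ (proj₂ (winner (nodes T 1≤v v<n (λ ())))))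

    -- Follow the winner downwards: each entry repeats that of one of the two children. A child has
    -- a larger number than its parent, so 2n - u bounds the rest of the descent.
    leaf-of : Tree leaf out mem 0 → ∀ fuel {u} → 1 ℕ.≤ u → u ℕ.< n ℕ.+ n → n ℕ.+ n ℕ.≤ u ℕ.+ fuel →
              ∃[ j ] j ℕ.< n × mem u ≡ leaf j
    leaf-of T zero {u} 1≤u u<2n 2n≤u+0 =
      contradiction u<2n (ℕ.≤⇒≯ (subst (n ℕ.+ n ℕ.≤_) (ℕ.+-identityʳ u) 2n≤u+0))
    leaf-of T (suc fuel) {u} 1≤u u<2n 2n≤u+fuel with u ℕ.<? n
    ... | no u≮n = u ℕ.∸ n , j<n , trans (cong mem (sym n+j≡u)) (leaves T j<n)
      where
      n+j≡u : n ℕ.+ (u ℕ.∸ n) ≡ u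
      n+j≡u = ℕ.m+[n∸m]≡n (ℕ.≮⇒≥ u≮n)
      j<n : u ℕ.∸ n ℕ.< n
      j<n = ℕ.+-cancelˡ-< n _ _ (subst (ℕ._< n ℕ.+ n) (sym n+j≡u) u<2n)
    ... | yes u<n with proj₁ (winner (nodes T 1≤u u<n (ℕ.>⇒≢ 1≤u)))
    ...   | inj₁ eq = map₂ (map₂ (trans eq)) (leaf-of T fuel (ℕ.≤-trans 1≤u (ℕ.m≤m+n u u)) (m<n⇒m+m<n+n u<n)
              (ℕ.≤-trans 2n≤u+fuel (ℕ.≤-trans (ℕ.≤-reflexive (ℕ.+-suc u fuel))
                (ℕ.+-monoˡ-≤ fuel (ℕ.m<m+n u 1≤u)))))
    ...   | inj₂ eq = map₂ (map₂ (trans eq)) (leaf-of T fuel (ℕ.m≤n+m 1 (u ℕ.+ u)) (m<n⇒m+m+1<n+n u<n)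
              (ℕ.≤-trans 2n≤u+fuel (ℕ.≤-trans (ℕ.≤-reflexive (ℕ.+-suc u fuel))
                (ℕ.+-monoˡ-≤ fuel (ℕ.≤-trans (ℕ.m<m+n u 1≤u) (ℕ.m≤m+n _ 1))))))

    -- The condition at w reads only the cells w, 2w and 2w+1, and the last two are those whose half
    -- is w.
    NodeOK-↦ : ∀ {v x w} → w ≢ v → w ≢ ⌊ v /2⌋ → NodeOK mem w → NodeOK (mem [ v ↦ x ]) w
    NodeOK-↦ {v} {x} {w} w≢v w≢⌊v/2⌋ ok
      = nodeOK (rewritten (↦-other mem w≢v)
          (↦-other mem {k = v} {x = x} λ 2w≡v → w≢⌊v/2⌋ (trans (sym (⌊n+n/2⌋ w)) (cong ⌊_/2⌋ 2w≡v)))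
          (↦-other mem {k = v} {x = x} λ 2w+1≡v → w≢⌊v/2⌋ (trans (sym (⌊n+n+1/2⌋ w)) (cong ⌊_/2⌋ 2w+1≡v))))
      where
      rewritten : ∀ {a b c} → a ≡ mem w → b ≡ mem (w ℕ.+ w) → c ≡ mem (w ℕ.+ w ℕ.+ 1) → Winner a b c
      rewritten refl refl refl = winner ok

    set-leaf : Tree leaf out mem 0 → ∀ {j} x → j ℕ.< n →
               Tree (leaf [ j ↦ x ]) out (mem [ n ℕ.+ j ↦ x ]) ⌊ n ℕ.+ j /2⌋
    set-leaf T {j} x j<n = record
      { nodes  = λ 1≤w w<n w≢hole → NodeOK-↦ (ℕ.<⇒≢ (ℕ.<-≤-trans w<n (ℕ.m≤m+n n j))) w≢hole (nodes T 1≤w w<n (ℕ.>⇒≢ 1≤w))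
      ; leaves = leaf-case
      ; outs   = λ k → trans (↦-other mem (λ eq → ℕ.<⇒≢ (ℕ.<-≤-trans j<n (ℕ.m≤m+n n k))
                          (sym (ℕ.+-cancelˡ-≡ n _ _ (trans (sym (ℕ.+-assoc n n k)) eq))))) (outs T k)
      }
      where
      leaf-case : ∀ {i} → i ℕ.< n → (mem [ n ℕ.+ j ↦ x ]) (n ℕ.+ i) ≡ (leaf [ j ↦ x ]) i
      leaf-case {i} i<n with i ℕ.≟ j
      ... | yes refl = trans (↦-same mem (n ℕ.+ j)) (sym (↦-same leaf j))
      ... | no i≢j = trans (↦-other mem (λ eq → i≢j (ℕ.+-cancelˡ-≡ n _ _ eq))) (trans (leaves T i<n) (sym (↦-other leaf i≢j)))

    set-node : ∀ {v x} → Tree leaf out mem v → 1 ℕ.≤ v → v ℕ.< n →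
               Winner x (mem (v ℕ.+ v)) (mem (v ℕ.+ v ℕ.+ 1)) →
               Tree leaf out (mem [ v ↦ x ]) ⌊ v /2⌋
    set-node {v} {x} T 1≤v v<n win = record
      { nodes  = node-case
      ; leaves = λ j<n → trans (↦-other mem (λ eq → ℕ.<⇒≢ (ℕ.<-≤-trans v<n (ℕ.m≤m+n n _)) (sym eq))) (leaves T j<n)
      ; outs   = λ k → trans (↦-other mem (λ eq → ℕ.<⇒≢ (ℕ.<-≤-trans v<n (ℕ.≤-trans (ℕ.m≤m+n n n) (ℕ.m≤m+n _ k))) (sym eq))) (outs T k)
      }
      where
      node-case : ∀ {w} → 1 ℕ.≤ w → w ℕ.< n → w ≢ ⌊ v /2⌋ → NodeOK (mem [ v ↦ x ]) w
      node-case {w} 1≤w w<n w≢hole with w ℕ.≟ v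
      ... | no w≢v = NodeOK-↦ w≢v w≢hole (nodes T 1≤w w<n w≢v)
      ... | yes refl = nodeOK (rewritten (↦-same mem v)
              (↦-other mem {x = x} λ eq → 1≤m⇒m≢m+m 1≤v (sym eq)) (↦-other mem {x = x} λ eq → m≢m+m+1 v (sym eq)))
        where
        rewritten : ∀ {a b c} → a ≡ x → b ≡ mem (v ℕ.+ v) → c ≡ mem (v ℕ.+ v ℕ.+ 1) → Winner a b c
        rewritten refl refl refl = win

    -- Half of an address 2n+k is at least n, hence no inner node; recording output therefore opens
    -- no hole.
    set-out : Tree leaf out mem 0 → ∀ k x → Tree leaf (out [ k ↦ x ]) (mem [ n ℕ.+ n ℕ.+ k ↦ x ]) 0
    set-out T k x = record
      { nodes  = λ 1≤w w<n w≢0 → NodeOK-↦ (below (ℕ.<-≤-trans w<n (ℕ.m≤m+n n n)))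
                   (λ w≡hole → ℕ.<⇒≱ w<n (subst (n ℕ.≤_) (sym w≡hole)
                     (subst (ℕ._≤ ⌊ n ℕ.+ n ℕ.+ k /2⌋) (⌊n+n/2⌋ n) (ℕ.⌊n/2⌋-mono (ℕ.m≤m+n (n ℕ.+ n) k)))))
                   (nodes T 1≤w w<n w≢0)
      ; leaves = λ j<n → trans (↦-other mem (below (ℕ.+-monoʳ-< n j<n))) (leaves T j<n)
      ; outs   = out-case
      }
      where
      below : ∀ {w} → w ℕ.< n ℕ.+ n → w ≢ n ℕ.+ n ℕ.+ k
      below w<2n eq = ℕ.<⇒≢ (ℕ.<-≤-trans w<2n (ℕ.m≤m+n _ k)) eq
      out-case : ∀ i → (mem [ n ℕ.+ n ℕ.+ k ↦ x ]) (n ℕ.+ n ℕ.+ i) ≡ (out [ k ↦ x ]) i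
      out-case i with i ℕ.≟ k
      ... | yes refl = trans (↦-same mem (n ℕ.+ n ℕ.+ k)) (sym (↦-same out k))
      ... | no i≢k = trans (↦-other mem (λ eq → i≢k (ℕ.+-cancelˡ-≡ (n ℕ.+ n) _ _ eq))) (trans (outs T i) (sym (↦-other out i≢k)))

  -- Among absent contestants every match is won vacuously. Starting from here, building the tree is
  -- just a sequence of leaf updates, the same operation that later removes winners.
  no-contestants : ∀ {mem} → (∀ {w} → w ℕ.< n ℕ.+ n → mem w ≡ n) →
                   Tree (λ _ → n) (λ k → mem (n ℕ.+ n ℕ.+ k)) mem 0
  no-contestants {mem} all = record
    { nodes  = λ {w} _ w<n _ → nodeOK
        ( inj₁ (trans (all (ℕ.<-≤-trans w<n (ℕ.m≤m+n n n))) (sym (all (m<n⇒m+m<n+n w<n))))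
        , ⊑-last (ℕ.≤-reflexive (sym (all (m<n⇒m+m<n+n w<n))))
        , ⊑-last (ℕ.≤-reflexive (sym (all (m<n⇒m+m+1<n+n w<n)))))
    ; leaves = λ j<n → all (ℕ.+-monoʳ-< n j<n)
    ; outs   = λ _ → refl
    }

-- Sorting by repeated extraction of the winner.

-- The function takes the bound on its argument because it will be a witness read off an existence
-- proof that holds for indices below n only.
pigeonhole : ∀ {m n} → m ℕ.< n → (f : ∀ i → i ℕ.< n → ℕ) → (∀ i i<n → f i i<n ℕ.< m) →
             ∃[ i ] ∃[ j ] ∃[ i<n ] ∃[ j<n ] i ℕ.< j × f i i<n ≡ f j j<n
pigeonhole m<n f f<m with Fin.pigeonhole m<n (λ i → fromℕ< (f<m (toℕ i) (Fin.toℕ<n i)))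
... | i , j , i<j , eq = toℕ i , toℕ j , Fin.toℕ<n i , Fin.toℕ<n j , i<j , Fin.fromℕ<-injective _ _ (f<m _ _) (f<m _ _) eq

module TournamentSort {c ℓ₁ ℓ₂} (R : OrderedField c ℓ₁ ℓ₂)
                      (n : ℕ) (P : ℕ → OrderedField.Carrier R) where
  open OrderedField R using (_<_; _≈_)
  open OrderedFieldProperties R using (<-irreflexive)
  open TournamentTree R n P

  record Extracted (m : ℕ) (leaf out : ℕ → ℕ) : Set ℓ₂ where
    field
      cover : ∀ {j} → j ℕ.< n → leaf j ≡ j ⊎ leaf j ≡ n × ∃[ k ] k ℕ.< m × out k ≡ j
      bound : ∀ {k} → k ℕ.< m → out k ℕ.< n
      below : ∀ {k j} → k ℕ.< m → j ℕ.< n → leaf j ≡ j → P (out k) < P j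
      mono  : ∀ {k l} → k ℕ.< l → l ℕ.< m → P (out k) < P (out l)
  open Extracted

  none-extracted : ∀ {leaf out} → (∀ {j} → j ℕ.< n → leaf j ≡ j) → Extracted 0 leaf out
  none-extracted all = record
    { cover = λ j<n → inj₁ (all j<n) ; bound = λ () ; below = λ () ; mono = λ _ () }

  module _ {leaf out mem m} (T : Tree leaf out mem 0) (E : Extracted m leaf out) where

    absent⇒extracted : ¬ mem 1 ℕ.< n → ∀ {j} → j ℕ.< n → ∃[ k ] k ℕ.< m × out k ≡ j
    absent⇒extracted root≮n {j} j<n with cover E j<n
    ... | inj₂ (_ , k) = k
    ... | inj₁ leafj≡j = contradiction
            (proj₁ (root-wins T (ℕ.≤-trans (ℕ.≤-trans (s≤s z≤n) j<n) (ℕ.m≤m+n n j)) (ℕ.+-monoʳ-< n j<n)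
              (subst (ℕ._< n) (sym (trans (leaves T j<n) leafj≡j)) j<n)))
            root≮n

    -- With an absent winner every leaf is vacated, so all n indices occur among the m < n extracted
    -- ones and two of them share a position.
    root-present : m ℕ.< n → mem 1 ℕ.< n
    root-present m<n with mem 1 ℕ.<? n
    ... | yes root<n = root<n
    ... | no root≮n
      with i , j , i<n , j<n , i<j , k≡l ← pigeonhole m<n
             (λ _ j<n → proj₁ (absent⇒extracted root≮n j<n))
             (λ _ j<n → proj₁ (proj₂ (absent⇒extracted root≮n j<n)))
      = contradiction i<j (ℕ.≤⇒≯ (ℕ.≤-reflexive (trans (sym (outrank j<n)) (trans (cong out (sym k≡l)) (outrank i<n)))))
      where
      outrank : ∀ {j} (j<n : j ℕ.< n) → out (proj₁ (absent⇒extracted root≮n j<n)) ≡ j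
      outrank j<n = proj₂ (proj₂ (absent⇒extracted root≮n j<n))

    module _ (distinct : ∀ {i j} → i ℕ.< n → j ℕ.< n → P i ≈ P j → i ≡ j) (m<n : m ℕ.< n) where

      private
        i = mem 1
        i<n : i ℕ.< n
        i<n = root-present m<n

      -- The winner's value comes from some leaf; being below n, it is not the mark of a vacated
      -- leaf, so that leaf still holds its own index.
      leaf-root : leaf i ≡ i
      leaf-root with leaf-of T (n ℕ.+ n) (s≤s z≤n) (ℕ.+-mono-≤ 1≤n 1≤n) (ℕ.m≤n+m _ 1)
        where
        1≤n : 1 ℕ.≤ n
        1≤n = ℕ.≤-trans (s≤s z≤n) m<n
      ... | j , j<n , i≡leafj with cover E j<n
      ...   | inj₁ leafj≡j = subst (λ j → leaf j ≡ j) (sym (trans i≡leafj leafj≡j)) leafj≡j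
      ...   | inj₂ (leafj≡n , _) = contradiction (trans i≡leafj leafj≡n) (ℕ.<⇒≢ i<n)

      extracted-root : Extracted (suc m) (leaf [ i ↦ n ]) (out [ m ↦ i ])
      extracted-root = record { cover = cover′ ; bound = bound′ ; below = below′ ; mono = mono′ }
        where
        out-m : (out [ m ↦ i ]) m ≡ i
        out-m = ↦-same out m

        out-< : ∀ {k} → k ℕ.< m → (out [ m ↦ i ]) k ≡ out k
        out-< k<m = ↦-other out (ℕ.<⇒≢ k<m)

        cover′ : ∀ {j} → j ℕ.< n → (leaf [ i ↦ n ]) j ≡ j ⊎ (leaf [ i ↦ n ]) j ≡ n × ∃[ k ] k ℕ.< suc m × (out [ m ↦ i ]) k ≡ j
        cover′ {j} j<n with j ℕ.≟ i
        ... | yes refl = inj₂ (↦-same leaf i , m , ℕ.n<1+n m , out-m)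
        ... | no j≢i with cover E j<n
        ...   | inj₁ leafj≡j = inj₁ (trans (↦-other leaf j≢i) leafj≡j)
        ...   | inj₂ (leafj≡n , k , k<m , outk≡j) =
                  inj₂ (trans (↦-other leaf j≢i) leafj≡n , k , ℕ.m<n⇒m<1+n k<m , trans (out-< k<m) outk≡j)

        bound′ : ∀ {k} → k ℕ.< suc m → (out [ m ↦ i ]) k ℕ.< n
        bound′ {k} k<1+m with ℕ.m<1+n⇒m<n∨m≡n k<1+m
        ... | inj₁ k<m = subst (ℕ._< n) (sym (out-< k<m)) (bound E k<m)
        ... | inj₂ refl = subst (ℕ._< n) (sym out-m) i<n

        root-least : ∀ {j} → j ℕ.< n → j ≢ i → leaf j ≡ j → P i < P j
        root-least {j} j<n j≢i leafj≡j with OrderedField.compare R (P i) (P j)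
        ... | tri< i<j _ _ = i<j
        ... | tri≈ _ i≈j _ = contradiction (sym (distinct i<n j<n i≈j)) j≢i
        ... | tri> _ _ j<i = contradiction
                (subst (λ x → P x < P i) (sym memj≡j) j<i)
                (proj₂ (root-wins T (ℕ.≤-trans (ℕ.≤-trans (s≤s z≤n) j<n) (ℕ.m≤m+n n j)) (ℕ.+-monoʳ-< n j<n)
                  (subst (ℕ._< n) (sym memj≡j) j<n)))
          where
          memj≡j : mem (n ℕ.+ j) ≡ j
          memj≡j = trans (leaves T j<n) leafj≡j

        below′ : ∀ {k j} → k ℕ.< suc m → j ℕ.< n → (leaf [ i ↦ n ]) j ≡ j → P ((out [ m ↦ i ]) k) < P j
        below′ {k} {j} k<1+m j<n leafj≡j with j ℕ.≟ i
        ... | yes refl = contradiction (trans (sym leafj≡j) (↦-same leaf i)) (ℕ.<⇒≢ i<n)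
        ... | no j≢i with ℕ.m<1+n⇒m<n∨m≡n k<1+m
        ...   | inj₁ k<m = subst (λ x → P x < P j) (sym (out-< k<m)) (below E k<m j<n (trans (sym (↦-other leaf j≢i)) leafj≡j))
        ...   | inj₂ refl = subst (λ x → P x < P j) (sym out-m) (root-least j<n j≢i (trans (sym (↦-other leaf j≢i)) leafj≡j))

        mono′ : ∀ {k l} → k ℕ.< l → l ℕ.< suc m → P ((out [ m ↦ i ]) k) < P ((out [ m ↦ i ]) l)
        mono′ k<l l<1+m with ℕ.m<1+n⇒m<n∨m≡n l<1+m
        ... | inj₁ l<m = subst₂ (λ x y → P x < P y) (sym (out-< (ℕ.<-trans k<l l<m))) (sym (out-< l<m)) (mono E k<l l<m)
        ... | inj₂ refl = subst₂ (λ x y → P x < P y) (sym (out-< k<l)) (sym out-m) (below E k<l i<n leaf-root)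

  record Sorted (out : ℕ → ℕ) : Set ℓ₂ where
    field
      out<n      : ∀ {k} → k ℕ.< n → out k ℕ.< n
      increasing : ∀ {k l} → k ℕ.< l → l ℕ.< n → P (out k) < P (out l)
      exhaustive : ∀ {j} → j ℕ.< n → ∃[ k ] k ℕ.< n × out k ≡ j

  no-chain : ∀ {g : ℕ → ℕ} → (∀ k → k ℕ.< suc n → g k ℕ.< n) →
             ¬ (∀ {k l} → k ℕ.< l → l ℕ.< suc n → P (g k) < P (g l))
  no-chain {g} bounded mono
    with k , l , _ , l<1+n , k<l , eq ← pigeonhole (ℕ.n<1+n n) (λ k _ → g k) bounded
    = <-irreflexive (subst (λ x → P (g k) < P x) (sym eq) (mono k<l l<1+n))

  -- An index still present after n extractions would prolong the output to a strictly increasing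
  -- chain of n+1 indices below n.
  all-extracted : ∀ {leaf out} → Extracted n leaf out → Sorted out
  all-extracted {leaf} {out} E = record { out<n = bound E ; increasing = mono E ; exhaustive = exhaustive }
    where
    exhaustive : ∀ {j} → j ℕ.< n → ∃[ k ] k ℕ.< n × out k ≡ j
    exhaustive {j} j<n with cover E j<n
    ... | inj₂ (_ , k) = k
    ... | inj₁ leafj≡j = ⊥-elim (no-chain bound′ mono′)
      where
      out-< : ∀ {k} → k ℕ.< n → (out [ n ↦ j ]) k ≡ out k
      out-< k<n = ↦-other out (ℕ.<⇒≢ k<n)

      bound′ : ∀ k → k ℕ.< suc n → (out [ n ↦ j ]) k ℕ.< n
      bound′ k k<1+n with ℕ.m<1+n⇒m<n∨m≡n k<1+n
      ... | inj₁ k<n = subst (ℕ._< n) (sym (out-< k<n)) (bound E k<n)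
      ... | inj₂ refl = subst (ℕ._< n) (sym (↦-same out n)) j<n

      mono′ : ∀ {k l} → k ℕ.< l → l ℕ.< suc n → P ((out [ n ↦ j ]) k) < P ((out [ n ↦ j ]) l)
      mono′ k<l l<1+n with ℕ.m<1+n⇒m<n∨m≡n l<1+n
      ... | inj₁ l<n = subst₂ (λ x y → P x < P y) (sym (out-< (ℕ.<-trans k<l l<n))) (sym (out-< l<n)) (mono E k<l l<n)
      ... | inj₂ refl = subst₂ (λ x y → P x < P y) (sym (out-< k<l)) (sym (↦-same out n)) (below E k<l j<n leafj≡j)

-- The scan for steepest slopes.

module SlopeScan {c ℓ₁ ℓ₂} (R : OrderedField c ℓ₁ ℓ₂) (X Y : ℕ → OrderedField.Carrier R)
  where
  open OrderedField R using (Carrier; _<_; _≤_)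
  open OrderedFieldProperties R
  open Slopes X Y

  SteepestTo : ℕ → ℕ → Set (ℓ₁ ⊔ ℓ₂)
  SteepestTo i k = ∀ {j} → j ℕ.< k → Below (slope i k) j k

  -- Point 0 is its own parent, so there the walk compares a slope with itself and stops; no test
  -- for the end of the chain is needed. `depth` exists in the proof only, to pay for the walk.
  record Forest (parent depth : ℕ → ℕ) (q : ℕ) : Set (ℓ₁ ⊔ ℓ₂) where
    field
      parent-0   : parent 0 ≡ 0
      parent-<   : ∀ {k} → 0 ℕ.< k → k ℕ.< q → parent k ℕ.< k
      depth-suc  : ∀ {k} → 0 ℕ.< k → k ℕ.< q → depth k ≡ suc (depth (parent k))
      steepest   : ∀ {k} → 0 ℕ.< k → k ℕ.< q → SteepestTo (parent k) k
  open Forest public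

  single : ∀ {parent} → parent 0 ≡ 0 → Forest parent (λ _ → 0) 1
  single parent0≡0 = record
    { parent-0  = parent0≡0
    ; parent-<  = λ { (s≤s _) (s≤s ()) }
    ; depth-suc = λ { (s≤s _) (s≤s ()) }
    ; steepest  = λ { (s≤s _) (s≤s ()) }
    }

  grow : ∀ {parent depth q i} → Forest parent depth q → 0 ℕ.< q → i ℕ.< q → SteepestTo i q →
         Forest (parent [ q ↦ i ]) (depth [ q ↦ suc (depth i) ]) (suc q)
  grow {parent} {depth} {q} {i} F 0<q i<q best = record
    { parent-0  = trans (↦-other parent (ℕ.<⇒≢ 0<q)) (parent-0 F)
    ; parent-<  = parent-<′
    ; depth-suc = depth-suc′
    ; steepest  = steepest′
    }
    where
    parent-q : (parent [ q ↦ i ]) q ≡ i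
    parent-q = ↦-same parent q

    old : ∀ {k} → k ℕ.< q → (parent [ q ↦ i ]) k ≡ parent k
    old k<q = ↦-other parent (ℕ.<⇒≢ k<q)

    parent-<′ : ∀ {k} → 0 ℕ.< k → k ℕ.< suc q → (parent [ q ↦ i ]) k ℕ.< k
    parent-<′ {k} 0<k k<1+q with ℕ.m<1+n⇒m<n∨m≡n k<1+q
    ... | inj₁ k<q = subst (ℕ._< k) (sym (old k<q)) (parent-< F 0<k k<q)
    ... | inj₂ refl = subst (ℕ._< q) (sym parent-q) i<q

    depth-suc′ : ∀ {k} → 0 ℕ.< k → k ℕ.< suc q →
                 (depth [ q ↦ suc (depth i) ]) k ≡ suc ((depth [ q ↦ suc (depth i) ]) ((parent [ q ↦ i ]) k))
    depth-suc′ {k} 0<k k<1+q with ℕ.m<1+n⇒m<n∨m≡n k<1+q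
    ... | inj₂ refl = trans (↦-same depth q)
            (cong suc (sym (trans (cong (depth [ q ↦ suc (depth i) ]) parent-q) (↦-other depth (ℕ.<⇒≢ i<q)))))
    ... | inj₁ k<q = trans (↦-other depth (ℕ.<⇒≢ k<q)) (trans (depth-suc F 0<k k<q)
            (cong suc (sym (trans (cong (depth [ q ↦ suc (depth i) ]) (old k<q))
              (↦-other depth (ℕ.<⇒≢ (ℕ.<-trans (parent-< F 0<k k<q) k<q)))))))

    steepest′ : ∀ {k} → 0 ℕ.< k → k ℕ.< suc q → SteepestTo ((parent [ q ↦ i ]) k) k
    steepest′ {k} 0<k k<1+q {j} j<k with ℕ.m<1+n⇒m<n∨m≡n k<1+q
    ... | inj₁ k<q = subst (λ p → Below (slope p k) j k) (sym (old k<q)) (steepest F 0<k k<q j<k)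
    ... | inj₂ refl = subst (λ p → Below (slope p q) j q) (sym parent-q) (best j<k)

  -- The invariant of the walk: i beats all points to its right, including those that left the chain
  -- long before q.
  Candidate : ℕ → ℕ → Set (ℓ₁ ⊔ ℓ₂)
  Candidate i q = ∀ {j} → i ℕ.< j → j ℕ.< q → Below (slope i q) j q

  last-candidate : ∀ {q} → Candidate q (suc q)
  last-candidate q<j j<1+q = contradiction q<j (ℕ.≤⇒≯ (ℕ.s≤s⁻¹ j<1+q))

  pop-positive : ∀ {parent depth i q} → Forest parent depth q → slope i q < slope (parent i) q → 0 ℕ.< i
  pop-positive {i = suc i} _ _ = s≤s z≤n
  pop-positive {i = zero} {q} F i<p = contradiction
    (subst (λ p → slope 0 q < slope p q) (parent-0 F) i<p) <-irreflexive

  module _ {parent depth q i} (F : Forest parent depth q) (i<q : i ℕ.< q)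
           (increasing : ∀ {k l} → k ℕ.< l → l ℕ.≤ q → X k < X l) where

    -- To the right of i the old bound survives because the slope has grown. Strictly between
    -- `parent i` and i, `steepest` places the points on or above the chord from `parent i` to i,
    -- which `Below-pop` turns into the chord from `parent i` to q.
    pop : slope i q < slope (parent i) q → Candidate i q → Candidate (parent i) q
    pop i<p cand {j} p<j j<q with ℕ.<-cmp j i
    ... | tri> _ _ i<j = Below-weaken (<⇒≤ i<p) (increasing j<q ℕ.≤-refl) (cand i<j j<q)
    ... | tri≈ _ refl _ = Below-weaken (<⇒≤ i<p) (increasing j<q ℕ.≤-refl) (Below-slope (increasing j<q ℕ.≤-refl))
    ... | tri< j<i _ _ = Below-pop
            (increasing (parent-< F 0<i i<q) (ℕ.<⇒≤ i<q)) (increasing i<q ℕ.≤-refl) (<⇒≤ i<p)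
            (increasing p<j (ℕ.<⇒≤ j<q)) (steepest F 0<i i<q j<i)
      where
      0<i : 0 ℕ.< i
      0<i = pop-positive F i<p

    -- Points to the right of i are covered by the candidate property. By `steepest`, all points to
    -- its left, even beyond `parent i`, lie on or above the line through i and `parent i`, and
    -- `Below-stop` applies to each of them.
    stop : slope (parent i) q ≤ slope i q → Candidate i q → SteepestTo i q
    stop p≤i cand {j} j<q with ℕ.<-cmp j i
    ... | tri> _ _ i<j = cand i<j j<q
    ... | tri≈ _ refl _ = Below-slope (increasing j<q ℕ.≤-refl)
    ... | tri< j<i _ _ = Below-stop
            (increasing (parent-< F 0<i i<q) (ℕ.<⇒≤ i<q)) (increasing i<q ℕ.≤-refl) p≤i
            (increasing j<i (ℕ.<⇒≤ i<q)) (steepest F 0<i i<q j<i)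
      where
      0<i : 0 ℕ.< i
      0<i = ℕ.≤-<-trans z≤n j<i

  -- The maximum of `old` and the slopes to the points before q, given by its universal property.
  -- Including `old` accumulates the passes in one cell and gives the first point, which has no
  -- slope, a value.
  record IsMaxSlope (old : Carrier) (q : ℕ) (new : Carrier) : Set (c ⊔ ℓ₁ ⊔ ℓ₂) where
    field
      old≤new : old ≤ new
      bounds  : ∀ {j} → j ℕ.< q → Below new j q
      least   : ∀ {K} → old ≤ K → (∀ {j} → j ℕ.< q → Below K j q) → new ≤ K
  open IsMaxSlope public

  max-slope-0 : ∀ {old} → IsMaxSlope old 0 old
  max-slope-0 = record { old≤new = ≤-refl ; bounds = λ () ; least = λ old≤K _ → old≤K }

  module _ {old : Carrier} {i q : ℕ} (i<q : i ℕ.< q) (increasing : ∀ {k} → k ℕ.< q → X k < X q)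
           (best : SteepestTo i q) where

    max-slope-new : old ≤ slope i q → IsMaxSlope old q (slope i q)
    max-slope-new old≤slope = record
      { old≤new = old≤slope
      ; bounds  = best
      ; least   = λ _ below → slope-least (increasing i<q) (below i<q)
      }

    max-slope-old : slope i q ≤ old → IsMaxSlope old q old
    max-slope-old slope≤old = record
      { old≤new = ≤-refl
      ; bounds  = λ j<q → Below-weaken slope≤old (increasing j<q) (best j<q)
      ; least   = λ old≤K _ → old≤K
      }

-- Timed execution of programs.

infixr 4 _»_

_»_ : Instruction → List Instruction → List Instruction
_»_ = _∷_

block : List Instruction → Program
block = foldr (λ I P → instr I ⨾ P) skip

module Execution {c ℓ₁ ℓ₂} (R : OrderedField c ℓ₁ ℓ₂) where
  open OrderedField R using (_<_; _<?_)
  open RealRAM R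

  Runs : ∀ {ℓ} → Program → State → ℕ → (State → Set ℓ) → Set (c ⊔ ℓ₁ ⊔ ℓ)
  Runs P s T Post = ∃₂ λ t s′ → ⟪ P , s ⟫⇓[ t ] s′ × t ℕ.≤ T × Post s′

  execs : List Instruction → State → State
  execs []       s = s
  execs (I ∷ Is) s = execs Is (exec I s)

  AllEnabled : List Instruction → State → Set ℓ₁
  AllEnabled []       s = ⊤
  AllEnabled (I ∷ Is) s = Enabled I s × AllEnabled Is (exec I s)

  module _ {ℓ} {Post : State → Set ℓ} where

    run-map : ∀ {ℓ′} {Post′ : State → Set ℓ′} {P s T} → (∀ s′ → Post s′ → Post′ s′) →
              Runs P s T Post → Runs P s T Post′
    run-map f (t , s′ , r , t≤T , post) = t , s′ , r , t≤T , f s′ post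

    run-skip : ∀ {s} → Post s → Runs skip s 0 Post
    run-skip post = 0 , _ , skip , z≤n , post

    run-instr : ∀ {I s} → Enabled I s → Post (exec I s) → Runs (instr I) s 1 Post
    run-instr enabled post = 1 , _ , instr enabled , s≤s z≤n , post

    -- The run of Q sits in the postcondition of P, so a proof about Q can use the concrete
    -- intermediate state and no separate assertion about it is needed.
    run-seq : ∀ {P Q s T U} → Runs P s T (λ s′ → Runs Q s′ U Post) → Runs (P ⨾ Q) s (T ℕ.+ U) Post
    run-seq (t , s′ , r , t≤T , (u , s″ , r′ , u≤U , post)) =
      t ℕ.+ u , s″ , seq r r′ , ℕ.+-mono-≤ t≤T u≤U , post

    -- Register numbers are literals, so `execs` reduces by computation, and most effects of
    -- straight-line code on registers hold by `refl`.
    run-block : ∀ Is {s} → AllEnabled Is s → Post (execs Is s) → Runs (block Is) s (length Is) Post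
    run-block []       _                post = run-skip post
    run-block (I ∷ Is) (enabled , rest) post with run-block Is rest post
    ... | t , s′ , r , t≤T , post′ = suc t , s′ , seq (instr enabled) r , s≤s t≤T , post′

    run-if : ∀ {B P Q s T U} → (holds B s ≡ true → Runs P s T Post) → (holds B s ≡ false → Runs Q s U Post) →
             Runs (ifte B P Q) s (suc (T ℕ.⊔ U)) Post
    run-if {B} {P} {Q} {s} {T} {U} yes-case no-case = by (holds B s) refl
      where
      by : ∀ b → holds B s ≡ b → Runs (ifte B P Q) s (suc (T ℕ.⊔ U)) Post
      by true eq with yes-case eq
      ... | t , s′ , r , t≤T , post = suc t , s′ , if-true eq r , s≤s (ℕ.≤-trans t≤T (ℕ.m≤m⊔n T U)) , post
      by false eq with no-case eq
      ... | t , s′ , r , t≤U , post = suc t , s′ , if-false eq r , s≤s (ℕ.≤-trans t≤U (ℕ.m≤n⊔m T U)) , post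

  does-true : ∀ {a} {A : Set a} (A? : Dec A) → does A? ≡ true → A
  does-true (yes a) _ = a

  does-false : ∀ {a} {A : Set a} (A? : Dec A) → does A? ≡ false → ¬ A
  does-false (no ¬a) _ = ¬a

  run-ifᴵ : ∀ {ℓ} {Post : State → Set ℓ} {i j P Q s T U} →
            (iReg s i ℕ.< iReg s j → Runs P s T Post) → (¬ iReg s i ℕ.< iReg s j → Runs Q s U Post) →
            Runs (ifte (i <ᴵ j) P Q) s (suc (T ℕ.⊔ U)) Post
  run-ifᴵ {i = i} {j} {s = s} yes-case no-case =
    run-if (λ eq → yes-case (does-true (iReg s i ℕ.<? iReg s j) eq))
           (λ eq → no-case (does-false (iReg s i ℕ.<? iReg s j) eq))

  run-ifᴿ : ∀ {ℓ} {Post : State → Set ℓ} {x y P Q s T U} →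
            (rReg s x < rReg s y → Runs P s T Post) → (¬ rReg s x < rReg s y → Runs Q s U Post) →
            Runs (ifte (x <ᴿ y) P Q) s (suc (T ℕ.⊔ U)) Post
  run-ifᴿ {x = x} {y} {s = s} yes-case no-case =
    run-if (λ eq → yes-case (does-true (rReg s x <? rReg s y) eq))
           (λ eq → no-case (does-false (rReg s x <? rReg s y) eq))

  -- m bounds the number of iterations that are left.
  run-while : ∀ {ℓ} {i j P C} (Inv : ℕ → State → Set ℓ) →
              (∀ {m s} → Inv m s → iReg s i ℕ.< iReg s j →
                 Runs P s C (λ s′ → ∃[ m′ ] m′ ℕ.< m × Inv m′ s′)) →
              ∀ {m s} → Inv m s →
              Runs (while (i <ᴵ j) P) s (suc (m ℕ.* suc C))
                (λ s′ → ¬ iReg s′ i ℕ.< iReg s′ j × ∃[ m′ ] Inv m′ s′)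
  run-while {ℓ} {i} {j} {P} {C} Inv body {m} inv = go m ℕ.≤-refl inv
    where
    Done : State → Set ℓ
    Done s′ = ¬ iReg s′ i ℕ.< iReg s′ j × ∃[ m′ ] Inv m′ s′

    -- An iteration may lower m by more than one, so the recursion is on a separate bound `fuel`.
    go : ∀ fuel {m s} → m ℕ.≤ fuel → Inv m s → Runs (while (i <ᴵ j) P) s (suc (m ℕ.* suc C)) Done
    by : ∀ fuel {m s} → m ℕ.≤ fuel → Inv m s → ∀ b → holds (i <ᴵ j) s ≡ b →
         Runs (while (i <ᴵ j) P) s (suc (m ℕ.* suc C)) Done
    go fuel {m} {s} m≤fuel inv = by fuel m≤fuel inv (holds (i <ᴵ j) s) refl
    by fuel {m} {s} _ inv false eq =
      1 , s , while-false eq , s≤s z≤n , does-false (iReg s i ℕ.<? iReg s j) eq , m , inv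
    by fuel {s = s} m≤fuel inv true eq with body inv (does-true (iReg s i ℕ.<? iReg s j) eq)
    by (suc fuel) {suc m} (s≤s m≤fuel) _ true eq | t , s′ , r , t≤C , m′ , s≤s m′≤m , inv′
      with go fuel (ℕ.≤-trans m′≤m m≤fuel) inv′
    ... | u , s″ , r′ , u≤ , done = suc (t ℕ.+ u) , s″ , while-true eq r r′ , s≤s bound , done
      where
      open ℕ.≤-Reasoning
      bound : t ℕ.+ u ℕ.≤ suc m ℕ.* suc C
      bound = begin
        t ℕ.+ u                       ≤⟨ ℕ.+-mono-≤ t≤C u≤ ⟩
        C ℕ.+ suc (m′ ℕ.* suc C)      ≡⟨ ℕ.+-suc C _ ⟩
        suc C ℕ.+ m′ ℕ.* suc C        ≤⟨ ℕ.+-monoʳ-≤ (suc C) (ℕ.*-monoˡ-≤ (suc C) m′≤m) ⟩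
        suc m ℕ.* suc C               ∎

-- The sorting program and its running time.

-- Index registers 0, 8 and 9 always hold n, 1 and 2n, and real registers 0
-- and 1 the signs by which the given p and f are multiplied.

loadChildren loadKeys : List Instruction
loadChildren = 3 ≔ᴵ add 2 2 » 4 ≔ᴵ load 3 » 3 ≔ᴵ add 3 8 » 5 ≔ᴵ load 3 » []
loadKeys = 2 ≔ᴿ load 4 » 2 ≔ᴿ mul 0 2 » 3 ≔ᴿ load 5 » 3 ≔ᴿ mul 0 3 » []

-- Index register 2 holds the node.
fixNode : Program
fixNode =
  block loadChildren ⨾
  ifte (5 <ᴵ 0)
    (ifte (4 <ᴵ 0)
      (block loadKeys ⨾
       ifte (3 <ᴿ 2) (instr (4 ≔ᴵ reg 5)) skip)
      (instr (4 ≔ᴵ reg 5)))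
    skip ⨾
  instr (storeᴵ 2 4)

setLeaf : Program
setLeaf = instr (storeᴵ 2 4) ⨾ while (8 <ᴵ 2) (instr (2 ≔ᴵ half 2) ⨾ fixNode)

clearInit clearCell nextLeaf extractRoot : List Instruction
clearInit = 1 ≔ᴵ lit 0 » 8 ≔ᴵ lit 1 » 9 ≔ᴵ add 0 0 » []
clearCell = storeᴵ 1 0 » 1 ≔ᴵ add 1 8 » []
nextLeaf = 2 ≔ᴵ add 0 1 » 4 ≔ᴵ reg 1 » []
-- Register 8 holds 1, here the address of the root. Leaf j holds j, so the winner also names the
-- leaf to vacate, and n in register 0 is the mark to put there.
extractRoot = 6 ≔ᴵ load 8 » 3 ≔ᴵ add 9 1 » storeᴵ 3 6 » 2 ≔ᴵ add 0 6 » 4 ≔ᴵ reg 0 » []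

clearTree fillTree emptyTree : Program
clearTree = block clearInit ⨾ while (1 <ᴵ 9) (block clearCell)
fillTree = instr (1 ≔ᴵ lit 0) ⨾
  while (1 <ᴵ 0) (block nextLeaf ⨾ setLeaf ⨾ instr (1 ≔ᴵ add 1 8))
emptyTree = instr (1 ≔ᴵ lit 0) ⨾
  while (1 <ᴵ 0) (block extractRoot ⨾ setLeaf ⨾ instr (1 ≔ᴵ add 1 8))

sort : Program
sort = clearTree ⨾ fillTree ⨾ emptyTree

-- A leaf below 2n is at most 1 + ⌊log₂ n⌋ halvings away from the root. Each costs 15: the loop
-- test, the halving and 13 for the node.
setLeafTime fillTime clearTime sortTime : ℕ → ℕ
setLeafTime n = suc (suc (suc ⌊log₂ n ⌋ ℕ.* 15))
fillTime n = suc (suc (n ℕ.* suc (suc (suc (setLeafTime n ℕ.+ 1)))))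
clearTime n = 3 ℕ.+ suc ((n ℕ.+ n) ℕ.* 3)
sortTime n = clearTime n ℕ.+ (fillTime n ℕ.+ suc (suc (n ℕ.* (6 ℕ.+ (setLeafTime n ℕ.+ 1)))))

-- Indexed by register contents instead of a state: after code that does not touch these registers
-- the type is definitionally the same, and the old proof is passed on as it is.
record Frame {a} {A : Set a} (n : ℕ) (sp sf : A) (i₀ i₈ i₉ : ℕ) (r₀ r₁ : A) : Set a where
  constructor frame
  field
    n≡    : i₀ ≡ n
    one≡  : i₈ ≡ 1
    2n≡   : i₉ ≡ n ℕ.+ n
    sp≡   : r₀ ≡ sp
    sf≡   : r₁ ≡ sf

countdown : ∀ {a b m n} → a ℕ.+ m ≡ n → b ≡ 1 → a ℕ.< n → ∃[ m′ ] m′ ℕ.< m × (a ℕ.+ b) ℕ.+ m′ ≡ n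
countdown {a} {m = zero} a+0≡n refl a<n =
  contradiction (trans (sym (ℕ.+-identityʳ a)) a+0≡n) (ℕ.<⇒≢ a<n)
countdown {a} {m = suc m} a+m≡n refl _ = m , ℕ.n<1+n m , trans (ℕ.+-assoc a 1 m) a+m≡n

counted : ∀ {a m n} → a ℕ.+ m ≡ n → ¬ a ℕ.< n → a ≡ n
counted {a} {m} a+m≡n a≮n = ℕ.≤-antisym (subst (a ℕ.≤_) a+m≡n (ℕ.m≤m+n a m)) (ℕ.≮⇒≥ a≮n)

m<n+1⇒m<n∨m≡n : ∀ {m n k} → k ≡ 1 → m ℕ.< n ℕ.+ k → m ℕ.< n ⊎ m ≡ n
m<n+1⇒m<n∨m≡n {m} {n} refl m<n+1 = ℕ.m<1+n⇒m<n∨m≡n (subst (m ℕ.<_) (ℕ.+-comm n 1) m<n+1)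

⌊log₂⌋-half : ∀ {v m} → 1 ℕ.< v → ⌊log₂ v ⌋ ℕ.≤ m → ∃[ m′ ] m′ ℕ.< m × ⌊log₂ ⌊ v /2⌋ ⌋ ℕ.≤ m′
⌊log₂⌋-half {v} {zero} 1<v log≤0 = contradiction (ℕ.≤-trans (⌊log₂⌋-mono-≤ 1<v) log≤0) λ ()
⌊log₂⌋-half {v} {suc m} 1<v log≤1+m = m , ℕ.n<1+n m ,
  subst (ℕ._≤ m) (sym (⌊log₂⌊n/2⌋⌋≡⌊log₂n⌋∸1 v)) (ℕ.∸-monoˡ-≤ 1 log≤1+m)

⌊log₂n+n⌋ : ∀ {n} → 1 ℕ.≤ n → ⌊log₂ n ℕ.+ n ⌋ ≡ suc ⌊log₂ n ⌋
⌊log₂n+n⌋ {n@(suc _)} _ = trans (cong (λ m → ⌊log₂ n ℕ.+ m ⌋) (sym (ℕ.+-identityʳ n))) (⌊log₂[2*b]⌋≡1+⌊log₂b⌋ n)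

-- Correctness of the sorting program.

module SortCorrect {c ℓ₁ ℓ₂} (R : OrderedField c ℓ₁ ℓ₂) (n : ℕ)
  (sp sf : OrderedField.Carrier R) (mem : ℕ → OrderedField.Carrier R) where
  open OrderedField R using (Carrier; _*_; _<_; _≈_; <-asym)
  open RealRAM R
  open Execution R

  P : ℕ → Carrier
  P k = sp * mem k

  open TournamentTree R n P
  open TournamentSort R n P

  record Env (i₀ i₈ i₉ : ℕ) (r₀ r₁ : Carrier) (rm : ℕ → Carrier) : Set c where
    constructor env
    field
      regs : Frame n sp sf i₀ i₈ i₉ r₀ r₁
      mem≡ : rm ≡ mem
    open Frame regs public
  open Env

  EnvS : State → Set c
  EnvS s = Env (iReg s 0) (iReg s 8) (iReg s 9) (rReg s 0) (rReg s 1) (rMem s)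

  read-P : ∀ s → EnvS s → ∀ k → rReg s 0 * rMem s k ≡ P k
  read-P s E k = cong₂ _*_ (sp≡ E) (cong (λ f → f k) (mem≡ E))

  NodeFixed : State → State → Set (c ⊔ ℓ₂)
  NodeFixed s s′ = EnvS s′ × iReg s′ 1 ≡ iReg s 1 × iReg s′ 2 ≡ v ×
    ∃[ x ] Winner x (iMem s (v ℕ.+ v)) (iMem s (v ℕ.+ v ℕ.+ 1)) × iMem s′ ≡ iMem s [ v ↦ x ]
    where v = iReg s 2

  -- One case for each way through the tests. The mark n of an absent child loses by `⊑-last`; it is
  -- filtered out before keys are loaded, since the real cell n holds no key.
  run-fixNode : ∀ {s} → EnvS s → Runs fixNode s 13 (NodeFixed s)
  run-fixNode {s} E = run-seq (run-block loadChildren _ (run-seq (run-ifᴵ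
    (λ b<n → run-ifᴵ
      (λ a<n → run-seq (run-block loadKeys _ (run-ifᴿ
        (λ b<a → run-instr _ (finish E refl refl refl refl (inj₂ refl) (λ _ → b<n′ b<n , λ a<b → <-asym a<b (P< b a b<a)) ⊑-refl))
        (λ b≮a → run-skip (finish E refl refl refl refl (inj₁ refl) ⊑-refl (λ _ → subst (a ℕ.<_) (n≡ E) a<n , λ b<a → b≮a (P<⁻¹ b a b<a)))))))
      (λ a≮n → run-instr _ (finish E refl refl refl refl (inj₂ refl) (⊑-last (ℕ.≮⇒≥ (λ a<n → a≮n (subst (a ℕ.<_) (sym (n≡ E)) a<n)))) ⊑-refl)))
    (λ b≮n → run-skip (finish E refl refl refl refl (inj₁ refl) ⊑-refl (⊑-last (ℕ.≮⇒≥ (λ b<n → b≮n (subst (b ℕ.<_) (sym (n≡ E)) b<n)))))))))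
    where
    v = iReg s 2
    a = iMem s (v ℕ.+ v)
    b = iMem s (v ℕ.+ v ℕ.+ iReg s 8)
    b<n′ : b ℕ.< iReg s 0 → b ℕ.< n
    b<n′ = subst (b ℕ.<_) (n≡ E)
    P< : ∀ i j → rReg s 0 * rMem s i < rReg s 0 * rMem s j → P i < P j
    P< i j = subst₂ _<_ (read-P s E i) (read-P s E j)
    P<⁻¹ : ∀ i j → P i < P j → rReg s 0 * rMem s i < rReg s 0 * rMem s j
    P<⁻¹ i j = subst₂ _<_ (sym (read-P s E i)) (sym (read-P s E j))
    finish : ∀ {s₁ x} → EnvS s₁ → iReg s₁ 1 ≡ iReg s 1 → iReg s₁ 2 ≡ v → iReg s₁ 4 ≡ x → iMem s₁ ≡ iMem s →
             x ≡ a ⊎ x ≡ b → x ⊑ a → x ⊑ b → Runs (instr (storeᴵ 2 4)) s₁ 1 (NodeFixed s)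
    finish {x = x} E₁ r₁ r₂ r₄ m₁ w∈ w⊑a w⊑b = run-instr _
      ( E₁ , r₁ , r₂ , x
      , subst (λ k → Winner x a (iMem s (v ℕ.+ v ℕ.+ k))) (one≡ E) (w∈ , w⊑a , w⊑b)
      , trans (cong₂ (λ k y → _ [ k ↦ y ]) r₂ r₄) (cong (λ f → f [ v ↦ x ]) m₁))

  -- The node v has just been written, so only its parent can be wrong. At the root the parent is
  -- ⌊1/2⌋ = 0, the value that stands for no hole.
  PathInv : (leaf out : ℕ → ℕ) → ℕ → ℕ → State → Set (c ⊔ ℓ₂)
  PathInv leaf out i m s = EnvS s × iReg s 1 ≡ i × 1 ℕ.≤ v × v ℕ.< n ℕ.+ n × ⌊log₂ v ⌋ ℕ.≤ m ×
    Tree leaf out (iMem s) ⌊ v /2⌋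
    where v = iReg s 2

  run-setLeaf : ∀ {leaf out j s} → EnvS s → iReg s 2 ≡ n ℕ.+ j → j ℕ.< n → Tree leaf out (iMem s) 0 →
                Runs setLeaf s (setLeafTime n)
                  (λ s′ → EnvS s′ × iReg s′ 1 ≡ iReg s 1 × Tree (leaf [ j ↦ iReg s 4 ]) out (iMem s′) 0)
  run-setLeaf {leaf} {out} {j} {s} E r₂ j<n T = run-seq (run-instr _
    (run-map finish (run-while (PathInv (leaf [ j ↦ x ]) out (iReg s 1)) climb {suc ⌊log₂ n ⌋}
      (E , refl , subst (1 ℕ.≤_) (sym r₂) (ℕ.≤-trans 1≤n (ℕ.m≤m+n n j)) , v<2n
      , ℕ.≤-trans (⌊log₂⌋-mono-≤ (ℕ.<⇒≤ v<2n)) (ℕ.≤-reflexive (⌊log₂n+n⌋ 1≤n))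
      , subst (λ v → Tree (leaf [ j ↦ x ]) out (iMem s [ v ↦ x ]) ⌊ v /2⌋) (sym r₂) (set-leaf T x j<n)))))
    where
    x = iReg s 4

    1≤n : 1 ℕ.≤ n
    1≤n = ℕ.≤-trans (s≤s z≤n) j<n

    v<2n : iReg s 2 ℕ.< n ℕ.+ n
    v<2n = subst (ℕ._< n ℕ.+ n) (sym r₂) (ℕ.+-monoʳ-< n j<n)

    finish : ∀ s′ → ¬ iReg s′ 8 ℕ.< iReg s′ 2 × ∃[ m ] PathInv (leaf [ j ↦ x ]) out (iReg s 1) m s′ →
             EnvS s′ × iReg s′ 1 ≡ iReg s 1 × Tree (leaf [ j ↦ x ]) out (iMem s′) 0
    finish s′ (1≮v , _ , E′ , r₁ , 1≤v , _ , _ , T′) = E′ , r₁ ,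
      subst (λ v → Tree (leaf [ j ↦ x ]) out (iMem s′) ⌊ v /2⌋)
        (ℕ.≤-antisym (ℕ.≮⇒≥ (λ 1<v → 1≮v (subst (ℕ._< iReg s′ 2) (sym (one≡ E′)) 1<v))) 1≤v) T′

    climb : ∀ {m s₁} → PathInv (leaf [ j ↦ x ]) out (iReg s 1) m s₁ → iReg s₁ 8 ℕ.< iReg s₁ 2 →
            Runs (instr (2 ≔ᴵ half 2) ⨾ fixNode) s₁ 14
              (λ s₂ → ∃[ m′ ] m′ ℕ.< m × PathInv (leaf [ j ↦ x ]) out (iReg s 1) m′ s₂)
    climb {m} {s₁} (E₁ , r₁ , 1≤v , v<2n , log≤m , T₁) 1<v = run-seq (run-instr _ (run-map next (run-fixNode E₁)))
      where
      v = iReg s₁ 2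
      1<v′ : 1 ℕ.< v
      1<v′ = subst (ℕ._< v) (one≡ E₁) 1<v
      next : ∀ s₂ → NodeFixed (exec (2 ≔ᴵ half 2) s₁) s₂ →
             ∃[ m′ ] m′ ℕ.< m × PathInv (leaf [ j ↦ x ]) out (iReg s 1) m′ s₂
      next s₂ (E₂ , r₁′ , r₂′ , y , win , mem₂) with ⌊log₂⌋-half 1<v′ log≤m
      ... | m′ , m′<m , log≤m′ = m′ , m′<m , E₂ , trans r₁′ r₁
          , subst (1 ℕ.≤_) (sym r₂′) (1≤⌊/2⌋ 1<v′)
          , subst (ℕ._< n ℕ.+ n) (sym r₂′) (ℕ.<-trans (⌊/2⌋<u 1≤v) v<2n)
          , subst (λ u → ⌊log₂ u ⌋ ℕ.≤ m′) (sym r₂′) log≤m′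
          , subst₂ (λ f u → Tree (leaf [ j ↦ x ]) out f ⌊ u /2⌋) (sym mem₂) (sym r₂′)
              (set-node T₁ (1≤⌊/2⌋ 1<v′) (⌊/2⌋-< v<2n) win)

  ClearInv : ℕ → State → Set c
  ClearInv m s = EnvS s × iReg s 1 ℕ.+ m ≡ n ℕ.+ n × (∀ {w} → w ℕ.< iReg s 1 → iMem s w ≡ n)

  run-clearTree : ∀ {s} → iReg s 0 ≡ n → rReg s 0 ≡ sp → rReg s 1 ≡ sf → rMem s ≡ mem →
                  Runs clearTree s (clearTime n) (λ s′ → EnvS s′ × ∃[ out ] Tree (λ _ → n) out (iMem s′) 0)
  run-clearTree {s} i₀ r₀ r₁ m₀ = run-seq (run-block clearInit _ (run-map finish
    (run-while ClearInv step {n ℕ.+ n} (env (frame i₀ refl (cong₂ ℕ._+_ i₀ i₀) r₀ r₁) m₀ , refl , λ ()))))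
    where
    finish : ∀ s′ → ¬ iReg s′ 1 ℕ.< iReg s′ 9 × ∃[ m ] ClearInv m s′ → EnvS s′ × ∃[ out ] Tree (λ _ → n) out (iMem s′) 0
    finish s′ (i≮2n , _ , E , i+m≡2n , clear) = E , _ , no-contestants λ {w} w<2n →
      clear (subst (w ℕ.<_) (sym (counted i+m≡2n (λ i<2n → i≮2n (subst (iReg s′ 1 ℕ.<_) (sym (2n≡ E)) i<2n)))) w<2n)

    step : ∀ {m s} → ClearInv m s → iReg s 1 ℕ.< iReg s 9 →
           Runs (block clearCell) s 2 (λ s′ → ∃[ m′ ] m′ ℕ.< m × ClearInv m′ s′)
    step {m} {s} (E , i+m≡2n , clear) i<2n with countdown i+m≡2n (one≡ E) (subst (iReg s 1 ℕ.<_) (2n≡ E) i<2n)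
    ... | m′ , m′<m , count = run-block clearCell _ (m′ , m′<m , E , count , λ {w} → clear′ {w})
      where
      clear′ : ∀ {w} → w ℕ.< iReg s 1 ℕ.+ iReg s 8 → (iMem s [ iReg s 1 ↦ iReg s 0 ]) w ≡ n
      clear′ w<i+1 with m<n+1⇒m<n∨m≡n (one≡ E) w<i+1
      ... | inj₁ w<i = trans (↦-other (iMem s) (ℕ.<⇒≢ w<i)) (clear w<i)
      ... | inj₂ refl = trans (↦-same (iMem s) _) (n≡ E)

  FillInv : ℕ → State → Set (c ⊔ ℓ₂)
  FillInv m s = EnvS s × iReg s 1 ℕ.+ m ≡ n ×
    ∃₂ λ leaf out → Tree leaf out (iMem s) 0 × (∀ {j} → j ℕ.< iReg s 1 → leaf j ≡ j)

  run-fillTree : ∀ {leaf out s} → EnvS s → Tree leaf out (iMem s) 0 →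
                 Runs fillTree s (fillTime n)
                   (λ s′ → EnvS s′ × ∃₂ λ leaf out → Tree leaf out (iMem s′) 0 × (∀ {j} → j ℕ.< n → leaf j ≡ j))
  run-fillTree {s = s} E T = run-seq (run-instr _ (run-map finish (run-while FillInv step (E , refl , _ , _ , T , λ ()))))
    where
    finish : ∀ s′ → ¬ iReg s′ 1 ℕ.< iReg s′ 0 × ∃[ m ] FillInv m s′ →
             EnvS s′ × ∃₂ λ leaf out → Tree leaf out (iMem s′) 0 × (∀ {j} → j ℕ.< n → leaf j ≡ j)
    finish s′ (i≮n , _ , E , i+m≡n , leaf , out , T , full) = E , leaf , out , T , λ {j} j<n →
      full (subst (j ℕ.<_) (sym (counted i+m≡n (λ i<n → i≮n (subst (iReg s′ 1 ℕ.<_) (sym (n≡ E)) i<n)))) j<n)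

    step : ∀ {m s} → FillInv m s → iReg s 1 ℕ.< iReg s 0 →
           Runs (block nextLeaf ⨾ setLeaf ⨾ instr (1 ≔ᴵ add 1 8)) s (2 ℕ.+ (setLeafTime n ℕ.+ 1))
             (λ s′ → ∃[ m′ ] m′ ℕ.< m × FillInv m′ s′)
    step {m} {s} (E , i+m≡n , leaf , out , T , full) i<n = run-seq (run-block nextLeaf _ (run-seq
      (run-map next (run-setLeaf E (cong (ℕ._+ i) (n≡ E)) i<n′ T))))
      where
      i = iReg s 1
      i<n′ : i ℕ.< n
      i<n′ = subst (i ℕ.<_) (n≡ E) i<n
      next : ∀ s₁ → EnvS s₁ × iReg s₁ 1 ≡ i × Tree (leaf [ i ↦ i ]) out (iMem s₁) 0 →
             Runs (instr (1 ≔ᴵ add 1 8)) s₁ 1 (λ s′ → ∃[ m′ ] m′ ℕ.< m × FillInv m′ s′)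
      next s₁ (E₁ , r₁ , T₁) with countdown i+m≡n (one≡ E₁) i<n′
      ... | m′ , m′<m , count = run-instr _
            (m′ , m′<m , E₁ , trans (cong (λ k → k ℕ.+ iReg s₁ 8 ℕ.+ m′) r₁) count , _ , _ , T₁ , λ {j} → full′ {j})
        where
        full′ : ∀ {j} → j ℕ.< iReg s₁ 1 ℕ.+ iReg s₁ 8 → (leaf [ i ↦ i ]) j ≡ j
        full′ {j} j<i+1 with m<n+1⇒m<n∨m≡n (one≡ E₁) (subst (λ k → j ℕ.< k ℕ.+ iReg s₁ 8) r₁ j<i+1)
        ... | inj₁ j<i = trans (↦-other leaf (ℕ.<⇒≢ j<i)) (full j<i)
        ... | inj₂ refl = ↦-same leaf j

  EmptyInv : ℕ → State → Set (c ⊔ ℓ₂)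
  EmptyInv m s = EnvS s × iReg s 1 ℕ.+ m ≡ n ×
    ∃₂ λ leaf out → Tree leaf out (iMem s) 0 × Extracted (iReg s 1) leaf out

  SortedState : State → Set (c ⊔ ℓ₂)
  SortedState s = EnvS s × ∃[ out ] Sorted out × (∀ k → iMem s (n ℕ.+ n ℕ.+ k) ≡ out k)

  module _ (distinct : ∀ {i j} → i ℕ.< n → j ℕ.< n → P i ≈ P j → i ≡ j) where

    run-emptyTree : ∀ {leaf out s} → EnvS s → Tree leaf out (iMem s) 0 → (∀ {j} → j ℕ.< n → leaf j ≡ j) →
                    Runs emptyTree s (suc (suc (n ℕ.* (6 ℕ.+ (setLeafTime n ℕ.+ 1))))) SortedState
    run-emptyTree {s = s} E T full = run-seq (run-instr _ (run-map finish
      (run-while EmptyInv step (E , refl , _ , _ , T , none-extracted full))))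
      where
      finish : ∀ s′ → ¬ iReg s′ 1 ℕ.< iReg s′ 0 × ∃[ m ] EmptyInv m s′ → SortedState s′
      finish s′ (i≮n , _ , E , i+m≡n , leaf , out , T , X) = E , out ,
        all-extracted (subst (λ k → Extracted k leaf out)
          (counted i+m≡n (λ i<n → i≮n (subst (iReg s′ 1 ℕ.<_) (sym (n≡ E)) i<n))) X) ,
        outs T

      step : ∀ {m s} → EmptyInv m s → iReg s 1 ℕ.< iReg s 0 →
             Runs (block extractRoot ⨾ setLeaf ⨾ instr (1 ≔ᴵ add 1 8)) s (5 ℕ.+ (setLeafTime n ℕ.+ 1))
               (λ s′ → ∃[ m′ ] m′ ℕ.< m × EmptyInv m′ s′)
      step {m} {s} (E , i+m≡n , leaf , out , T , X) i<n = run-seq (run-block extractRoot _ (run-seq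
        (run-map next (run-setLeaf {j = iMem s 1} E (cong₂ ℕ._+_ (n≡ E) (cong (iMem s) (one≡ E))) (root-present T X i<n′)
          (subst₂ (λ a r → Tree leaf (out [ i ↦ iMem s 1 ]) (iMem s [ a ↦ r ]) 0)
            (cong (ℕ._+ i) (sym (2n≡ E))) (cong (iMem s) (sym (one≡ E))) (set-out T i (iMem s 1)))))))
        where
        i = iReg s 1
        i<n′ : i ℕ.< n
        i<n′ = subst (i ℕ.<_) (n≡ E) i<n
        next : ∀ s₁ → EnvS s₁ × iReg s₁ 1 ≡ i × Tree (leaf [ iMem s 1 ↦ iReg s 0 ]) (out [ i ↦ iMem s 1 ]) (iMem s₁) 0 →
               Runs (instr (1 ≔ᴵ add 1 8)) s₁ 1 (λ s′ → ∃[ m′ ] m′ ℕ.< m × EmptyInv m′ s′)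
        next s₁ (E₁ , r₁ , T₁) with countdown i+m≡n (one≡ E₁) i<n′
        ... | m′ , m′<m , count = run-instr _
              ( m′ , m′<m , E₁ , trans (cong (λ k → k ℕ.+ iReg s₁ 8 ℕ.+ m′) r₁) count , _ , _ , T₁
              , subst₂ (λ k x → Extracted k (leaf [ iMem s 1 ↦ x ]) (out [ i ↦ iMem s 1 ]))
                  (trans (sym (ℕ.+-comm i 1)) (sym (cong₂ ℕ._+_ r₁ (one≡ E₁)))) (sym (n≡ E))
                  (extracted-root T X distinct i<n′))

    run-sort : ∀ {s} → iReg s 0 ≡ n → rReg s 0 ≡ sp → rReg s 1 ≡ sf → rMem s ≡ mem →
               Runs sort s (sortTime n) SortedState
    run-sort i₀ r₀ r₁ m₀ = run-seq (run-map
      (λ { _ (E , out , T) → run-seq (run-map (λ { _ (E , _ , _ , T , full) → run-emptyTree E T full }) (run-fillTree E T)) })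
      (run-clearTree i₀ r₀ r₁ m₀))

-- The scanning program and its correctness.

-- Index registers 1 and 2 hold q and the candidate i.  The parent pointers
-- occupy the index cells 0, …, n-1, which the tree no longer needs.
scanInit computeRises divideRises recordSlope nextPoint : List Instruction
scanInit = 3 ≔ᴵ lit 0 » storeᴵ 3 3 » 2 ≔ᴵ lit 0 » 1 ≔ᴵ lit 1 » []
computeRises =
  6 ≔ᴵ add 9 1 » 6 ≔ᴵ load 6 »
  2 ≔ᴿ load 6 » 2 ≔ᴿ mul 0 2 » 7 ≔ᴵ add 0 6 » 3 ≔ᴿ load 7 » 3 ≔ᴿ mul 1 3 »
  4 ≔ᴵ add 9 2 » 4 ≔ᴵ load 4 »
  4 ≔ᴿ load 4 » 4 ≔ᴿ mul 0 4 » 7 ≔ᴵ add 0 4 » 5 ≔ᴿ load 7 » 5 ≔ᴿ mul 1 5 »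
  5 ≔ᴵ load 2 » 3 ≔ᴵ add 9 5 » 3 ≔ᴵ load 3 »
  6 ≔ᴿ load 3 » 6 ≔ᴿ mul 0 6 » 7 ≔ᴵ add 0 3 » 7 ≔ᴿ load 7 » 7 ≔ᴿ mul 1 7 »
  4 ≔ᴿ sub 2 4 » 5 ≔ᴿ sub 3 5 » 6 ≔ᴿ sub 2 6 » 7 ≔ᴿ sub 3 7 » []
divideRises = 5 ≔ᴿ div 5 4 » 7 ≔ᴿ div 7 6 » []
recordSlope = storeᴵ 1 2 » 4 ≔ᴵ add 9 6 » 4 ≔ᴿ load 4 » []
nextPoint = 2 ≔ᴵ reg 1 » 1 ≔ᴵ add 1 8 » []

scanStep scan : Program
scanStep = block computeRises ⨾ block divideRises ⨾
  ifte (5 <ᴿ 7) (instr (2 ≔ᴵ reg 5))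
    (block recordSlope ⨾ ifte (4 <ᴿ 5) (instr (storeᴿ 4 5)) skip ⨾ block nextPoint)
scan = block scanInit ⨾ while (1 <ᴵ 0) scanStep

-- The potential starts at 2(n - 1) or less, so 2n bounds the number of iterations; each costs at
-- most 36 and the loop test.
scanTime : ℕ → ℕ
scanTime n = 4 ℕ.+ suc ((n ℕ.+ n) ℕ.* 37)

module ScanCorrect {c ℓ₁ ℓ₂} (R : OrderedField c ℓ₁ ℓ₂) (n : ℕ)
  (sp sf : OrderedField.Carrier R) (mem : ℕ → OrderedField.Carrier R)
  (σ : ℕ → ℕ) (sorted : TournamentSort.Sorted R n (λ k → OrderedField._*_ R sp (mem k)) σ) where
  open OrderedField R using (Carrier; _*_; _-_; _/_; _<_; _≤_; _≉_; 0#)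
  open OrderedFieldProperties R
  open RealRAM R
  open Execution R
  open TournamentSort.Sorted sorted

  X Y : ℕ → Carrier
  X k = sp * mem (σ k)
  Y k = sf * mem (n ℕ.+ σ k)

  open Slopes X Y using (slope)
  open SlopeScan R X Y

  answer : ℕ → ℕ
  answer k = n ℕ.+ n ℕ.+ σ k

  record Env (i₀ i₈ i₉ : ℕ) (r₀ r₁ : Carrier) (im : ℕ → ℕ) (rm : ℕ → Carrier) : Set c where
    field
      regs  : Frame n sp sf i₀ i₈ i₉ r₀ r₁
      order : ∀ {k} → k ℕ.< n → im (n ℕ.+ n ℕ.+ k) ≡ σ k
      given : ∀ {k} → k ℕ.< n ℕ.+ n → rm k ≡ mem k
    open Frame regs public
  open Env

  EnvS : State → Set c
  EnvS s = Env (iReg s 0) (iReg s 8) (iReg s 9) (rReg s 0) (rReg s 1) (iMem s) (rMem s)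

  -- Every iteration lowers the potential: a pop lowers the depth of i by one, and a push lowers n -
  -- q by one while the depth of the new candidate is one more than that of i. `finished` asks for k
  -- < n separately because q starts at 1 even if n is 0.
  record Progress (m q i : ℕ) (im : ℕ → ℕ) (rm : ℕ → Carrier) : Set (c ⊔ ℓ₁ ⊔ ℓ₂) where
    field
      0<q       : 0 ℕ.< q
      i<q       : i ℕ.< q
      depth     : ℕ → ℕ
      forest    : Forest im depth q
      potential : (n ℕ.∸ q) ℕ.+ (n ℕ.∸ q) ℕ.+ depth i ℕ.≤ m
      candidate : Candidate i q
      finished  : ∀ {k} → k ℕ.< q → k ℕ.< n → IsMaxSlope (mem (answer k)) k (rm (answer k))
      pending   : ∀ {k} → q ℕ.≤ k → k ℕ.< n → rm (answer k) ≡ mem (answer k)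

  Inv : ℕ → State → Set (c ⊔ ℓ₁ ⊔ ℓ₂)
  Inv m s = EnvS s × Progress m (iReg s 1) (iReg s 2) (iMem s) (rMem s)

  Scanned : State → Set (c ⊔ ℓ₁ ⊔ ℓ₂)
  Scanned s = EnvS s × (∀ {k} → k ℕ.< n → IsMaxSlope (mem (answer k)) k (rMem s (answer k)))

  -- Ensures that writing the answer of one rank leaves those of the other ranks intact.
  σ-injective : ∀ {k l} → k ℕ.< n → l ℕ.< n → σ k ≡ σ l → k ≡ l
  σ-injective {k} {l} k<n l<n eq with ℕ.<-cmp k l
  ... | tri< k<l _ _ = contradiction (subst (λ a → X k < sp * mem a) (sym eq) (increasing k<l l<n)) <-irreflexive
  ... | tri≈ _ k≡l _ = k≡l
  ... | tri> _ _ l<k = contradiction (subst (λ a → X l < sp * mem a) eq (increasing l<k k<n)) <-irreflexive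

  module Step {m} s (E : EnvS s) (G : Progress m (iReg s 1) (iReg s 2) (iMem s) (rMem s))
              (q<n : iReg s 1 ℕ.< n) where
    open Progress G

    q i p : ℕ
    q = iReg s 1
    i = iReg s 2
    p = iMem s i

    i<n : i ℕ.< n
    i<n = ℕ.<-trans i<q q<n

    p<q : p ℕ.< q
    p<q with i ℕ.≟ 0
    ... | yes i≡0 = subst (ℕ._< q) (sym (trans (cong (iMem s) i≡0) (parent-0 forest))) 0<q
    ... | no i≢0 = ℕ.<-trans (parent-< forest (ℕ.n≢0⇒n>0 i≢0) i<q) i<q

    p<n : p ℕ.< n
    p<n = ℕ.<-trans p<q q<n

    cell : ℕ → ℕ
    cell k = iMem s (iReg s 9 ℕ.+ k)

    cell≡ : ∀ {k} → k ℕ.< n → cell k ≡ σ k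
    cell≡ {k} k<n = trans (cong (λ a → iMem s (a ℕ.+ k)) (2n≡ E)) (order E k<n)

    -- Spelled as the machine computes them, so that register contents reduce to these terms; the
    -- equations below lead back to X, Y and `slope`.
    xOf yOf : ℕ → Carrier
    xOf k = rReg s 0 * rMem s (cell k)
    yOf k = rReg s 1 * rMem s (iReg s 0 ℕ.+ cell k)

    xOf≡ : ∀ {k} → k ℕ.< n → xOf k ≡ X k
    xOf≡ {k} k<n = cong₂ _*_ (sp≡ E)
      (trans (cong (rMem s) (cell≡ k<n)) (given E (ℕ.<-≤-trans (out<n k<n) (ℕ.m≤m+n n n))))

    yOf≡ : ∀ {k} → k ℕ.< n → yOf k ≡ Y k
    yOf≡ {k} k<n = cong₂ _*_ (sf≡ E)
      (trans (cong (rMem s) (cong₂ ℕ._+_ (n≡ E) (cell≡ k<n))) (given E (ℕ.+-monoʳ-< n (out<n k<n))))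

    slopeOf : ℕ → Carrier
    slopeOf k = (yOf q - yOf k) / (xOf q - xOf k)

    slopeOf≡ : ∀ {k} → k ℕ.< n → slopeOf k ≡ slope k q
    slopeOf≡ k<n = cong₂ _/_ (cong₂ _-_ (yOf≡ q<n) (yOf≡ k<n)) (cong₂ _-_ (xOf≡ q<n) (xOf≡ k<n))

    runs≉0 : ∀ {k} → k ℕ.< q → xOf q - xOf k ≉ 0#
    runs≉0 k<q = subst (_≉ 0#) (sym (cong₂ _-_ (xOf≡ q<n) (xOf≡ (ℕ.<-trans k<q q<n))))
      (x<y⇒y-x≉0 (increasing k<q q<n))

    increasing-q : ∀ {k l} → k ℕ.< l → l ℕ.≤ q → X k < X l
    increasing-q k<l l≤q = increasing k<l (ℕ.≤-<-trans l≤q q<n)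

    popped : slopeOf i < slopeOf p → ∃[ m′ ] m′ ℕ.< m × Progress m′ q p (iMem s) (rMem s)
    popped i<p = _ , ℕ.<-≤-trans (ℕ.+-monoʳ-< ((n ℕ.∸ q) ℕ.+ (n ℕ.∸ q))
        (ℕ.≤-reflexive (sym (depth-suc forest (pop-positive forest i<p′) i<q)))) potential , record
      { 0<q       = 0<q
      ; i<q       = p<q
      ; depth     = depth
      ; forest    = forest
      ; potential = ℕ.≤-refl
      ; candidate = pop forest i<q increasing-q i<p′ candidate
      ; finished  = finished
      ; pending   = pending
      }
      where
      i<p′ : slope i q < slope p q
      i<p′ = subst₂ _<_ (slopeOf≡ i<n) (slopeOf≡ p<n) i<p

    module Push (i≮p : ¬ slopeOf i < slopeOf p) where

      best : SteepestTo i q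
      best = stop forest i<q increasing-q (≮⇒≥ λ i<p → i≮p (subst₂ _<_ (sym (slopeOf≡ i<n)) (sym (slopeOf≡ p<n)) i<p)) candidate

      pushed : ∀ {rm} → (∀ {a} → a ≢ answer q → rm a ≡ rMem s a) →
               IsMaxSlope (mem (answer q)) q (rm (answer q)) →
               ∃[ m′ ] m′ ℕ.< m × Progress m′ (q ℕ.+ iReg s 8) q (iMem s [ q ↦ i ]) rm
      pushed {rm} same new = m′ , m′<m , subst (λ q′ → Progress m′ q′ q (iMem s [ q ↦ i ]) rm) q′≡ record
        { 0<q       = s≤s z≤n
        ; i<q       = ℕ.n<1+n q
        ; depth     = depth′
        ; forest    = grow forest 0<q i<q best
        ; potential = ℕ.≤-reflexive (cong ((n ℕ.∸ suc q) ℕ.+ (n ℕ.∸ suc q) ℕ.+_) (↦-same depth q))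
        ; candidate = last-candidate
        ; finished  = finished′
        ; pending   = λ q<k k<n → trans (same (other k<n (ℕ.>⇒≢ q<k))) (pending (ℕ.<⇒≤ q<k) k<n)
        }
        where
        depth′ = depth [ q ↦ suc (depth i) ]
        m′ = (n ℕ.∸ suc q) ℕ.+ (n ℕ.∸ suc q) ℕ.+ suc (depth i)

        q′≡ : suc q ≡ q ℕ.+ iReg s 8
        q′≡ = trans (ℕ.+-comm 1 q) (cong (q ℕ.+_) (sym (one≡ E)))

        m′<m : m′ ℕ.< m
        m′<m = ℕ.≤-trans (ℕ.≤-reflexive lemma) potential
          where
          r = n ℕ.∸ suc q
          lemma : suc m′ ≡ (n ℕ.∸ q) ℕ.+ (n ℕ.∸ q) ℕ.+ depth i
          lemma rewrite sym (ℕ.suc-pred (n ℕ.∸ q) {{ℕ.>-nonZero (ℕ.m<n⇒0<n∸m q<n)}}) | ℕ.pred[m∸n]≡m∸[1+n] n q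
                      | ℕ.+-suc r r | ℕ.+-suc (r ℕ.+ r) (depth i) = refl

        other : ∀ {k} → k ℕ.< n → k ≢ q → answer k ≢ answer q
        other k<n k≢q eq = k≢q (σ-injective k<n q<n (ℕ.+-cancelˡ-≡ (n ℕ.+ n) _ _ eq))

        finished′ : ∀ {k} → k ℕ.< suc q → k ℕ.< n → IsMaxSlope (mem (answer k)) k (rm (answer k))
        finished′ {k} k<1+q k<n with ℕ.m<1+n⇒m<n∨m≡n k<1+q
        ... | inj₂ refl = new
        ... | inj₁ k<q = subst (IsMaxSlope (mem (answer k)) k) (sym (same (other k<n (ℕ.<⇒≢ k<q)))) (finished k<q k<n)

      env′ : ∀ {rm} → (∀ {a} → a ≢ answer q → rm a ≡ rMem s a) →
             Env (iReg s 0) (iReg s 8) (iReg s 9) (rReg s 0) (rReg s 1) (iMem s [ q ↦ i ]) rm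
      env′ same = record
        { regs  = regs E
        ; order = λ {k} k<n → trans (↦-other (iMem s) (ℕ.>⇒≢ (ℕ.<-≤-trans q<n (ℕ.≤-trans (ℕ.m≤m+n n n) (ℕ.m≤m+n _ k))))) (order E k<n)
        ; given = λ k<2n → trans (same (ℕ.<⇒≢ (ℕ.<-≤-trans k<2n (ℕ.m≤m+n _ _)))) (given E k<2n)
        }

      old : Carrier
      old = rMem s (iReg s 9 ℕ.+ cell q)

      answer≡ : iReg s 9 ℕ.+ cell q ≡ answer q
      answer≡ = cong₂ ℕ._+_ (2n≡ E) (cell≡ q<n)

      old≡ : old ≡ mem (answer q)
      old≡ = trans (cong (rMem s) answer≡) (pending ℕ.≤-refl q<n)

      run-advance : ∀ {s₁} → Frame n sp sf (iReg s₁ 0) (iReg s₁ 8) (iReg s₁ 9) (rReg s₁ 0) (rReg s₁ 1) →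
                    iReg s₁ 1 ≡ q → iReg s₁ 8 ≡ iReg s 8 → iMem s₁ ≡ iMem s [ q ↦ i ] →
                    (∀ {a} → a ≢ answer q → rMem s₁ a ≡ rMem s a) →
                    IsMaxSlope (mem (answer q)) q (rMem s₁ (answer q)) →
                    Runs (block nextPoint) s₁ 2 (λ s′ → ∃[ m′ ] m′ ℕ.< m × Inv m′ s′)
      run-advance {s₁} regs₁ r₁ r₈ refl same new with pushed same new
      ... | m′ , m′<m , G′ = run-block nextPoint _ (m′ , m′<m , record { Env (env′ same) ; regs = regs₁ } ,
              subst₂ (λ a b → Progress m′ a b (iMem s [ q ↦ i ]) (rMem s₁)) (sym (cong₂ ℕ._+_ r₁ r₈)) (sym r₁) G′)

  run-scanStep : ∀ {m s} → Inv m s → iReg s 1 ℕ.< iReg s 0 →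
                 Runs scanStep s 36 (λ s′ → ∃[ m′ ] m′ ℕ.< m × Inv m′ s′)
  run-scanStep {m} {s} (E , G) q<i₀ = run-seq (run-block computeRises _ (run-seq (run-block divideRises
    -- Both divisions are enabled: i and its parent precede q, so their keys are strictly smaller.
    -- This includes i = 0, whose parent is 0.
    (runs≉0 i<q , runs≉0 p<q , _) (run-ifᴿ
      (λ i<p → let m′ , m′<m , G′ = popped i<p in run-instr _ (m′ , m′<m , E , G′))
      (λ (i≮p : ¬ slopeOf i < slopeOf p) → let open Push i≮p in run-seq (run-block recordSlope _ (run-seq (run-ifᴿ
        (λ old<slope → run-instr _ (run-advance (regs E) refl refl refl
          (λ a≢ → ↦-other (rMem s) (λ a≡ → a≢ (trans a≡ answer≡)))
          (subst (IsMaxSlope _ q) (sym (trans (↦-same′ (rMem s) (sym answer≡)) (slopeOf≡ i<n)))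
            (max-slope-new i<q (λ k<q → increasing k<q q<n) best (<⇒≤ (subst₂ _<_ old≡ (slopeOf≡ i<n) old<slope))))))
        (λ old≮slope → run-skip (run-advance (regs E) refl refl refl (λ _ → refl)
          (subst (IsMaxSlope _ q) (sym (Progress.pending G ℕ.≤-refl q<n))
            (max-slope-old i<q (λ k<q → increasing k<q q<n) best
              (subst₂ _≤_ (slopeOf≡ i<n) old≡ (≮⇒≥ old≮slope))))))))))))))
    where
    q<n = subst (iReg s 1 ℕ.<_) (n≡ E) q<i₀
    open Step s E G q<n
    open Progress G using (i<q)

  run-scan : ∀ {s} → Frame n sp sf (iReg s 0) (iReg s 8) (iReg s 9) (rReg s 0) (rReg s 1) → rMem s ≡ mem →
             (∀ k → iMem s (n ℕ.+ n ℕ.+ k) ≡ σ k) → Runs scan s (scanTime n) Scanned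
  run-scan {s} F refl order = run-seq (run-block scanInit _ (run-map finish (run-while Inv
    (λ { (E , G) q<n → run-scanStep (E , G) q<n })
    ( record { regs = F ; order = λ {k} k<n → trans (↦-other (iMem s) (ℕ.>⇒≢ (ℕ.≤-<-trans z≤n (ℕ.<-≤-trans k<n (ℕ.≤-trans (ℕ.m≤m+n n n) (ℕ.m≤m+n _ k)))))) (order k) ; given = λ _ → refl }
    , record
      { 0<q = s≤s z≤n ; i<q = s≤s z≤n ; depth = λ _ → 0
      ; forest = single refl
      ; potential = ℕ.≤-trans (ℕ.≤-reflexive (ℕ.+-identityʳ _)) (ℕ.+-mono-≤ (ℕ.m∸n≤m n 1) (ℕ.m∸n≤m n 1))
      ; candidate = last-candidate
      -- The first point has nothing to its left, so it is finished before the loop and its answer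
      -- is unchanged.
      ; finished = λ { (s≤s z≤n) _ → max-slope-0 }
      ; pending = λ _ _ → refl
      }))))
    where
    finish : ∀ s′ → ¬ iReg s′ 1 ℕ.< iReg s′ 0 × ∃[ m ] Inv m s′ → Scanned s′
    finish s′ (q≮n , _ , E , G) = E , λ k<n → Progress.finished G
      (ℕ.<-≤-trans k<n (ℕ.≮⇒≥ (λ q<n → q≮n (subst (iReg s′ 1 ℕ.<_) (sym (n≡ E)) q<n)))) k<n

-- The four passes and the total time.

open import Data.Nat.Base using (_*_; _^_)

signed : Sign → RealExpr
signed Sign.+ = add 2 3
signed Sign.- = sub 2 3

loadSigns : Sign → Sign → List Instruction
loadSigns ε δ = 2 ≔ᴿ zero » 3 ≔ᴿ one » 0 ≔ᴿ signed ε » 1 ≔ᴿ signed δ » []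

-- Raises each answer to the largest slope from its point down to a point
-- with smaller key, for the set reflected by the signs. The four passes
-- thus see both sides of each point and both signs of the difference.
pass : Sign → Sign → Program
pass ε δ = block (loadSigns ε δ) ⨾ sort ⨾ scan

lipschitzConstants : Program
lipschitzConstants = pass Sign.+ Sign.+ ⨾ pass Sign.+ Sign.- ⨾ pass Sign.- Sign.+ ⨾ pass Sign.- Sign.-

passTime totalTime : ℕ → ℕ
passTime n = 4 ℕ.+ (sortTime n ℕ.+ scanTime n)
totalTime n = passTime n ℕ.+ (passTime n ℕ.+ (passTime n ℕ.+ passTime n))

passTime≡ : ∀ n → passTime n ≡ 17 ℕ.+ 125 * n ℕ.+ 30 * (n * ⌊log₂ n ⌋)
passTime≡ n = expand n ⌊log₂ n ⌋
  where
  -- `passTime` unfolded, with the logarithm abstracted to a variable so that a polynomial identity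
  -- remains.
  expand : ∀ n l →
    4 ℕ.+ ((3 ℕ.+ (1 ℕ.+ (n ℕ.+ n) * 3) ℕ.+
      ((2 ℕ.+ n * (3 ℕ.+ (2 ℕ.+ (1 ℕ.+ l) * 15 ℕ.+ 1))) ℕ.+ (2 ℕ.+ n * (6 ℕ.+ (2 ℕ.+ (1 ℕ.+ l) * 15 ℕ.+ 1))))) ℕ.+
      (4 ℕ.+ (1 ℕ.+ (n ℕ.+ n) * 37)))
    ≡ 17 ℕ.+ 125 * n ℕ.+ 30 * (n * l)
  expand = solve-∀

-- From n = 2 on the logarithm is at least 1, so 1, n and n log n are all at most n log² n. Hence
-- 172 = 17 + 125 + 30 for a pass, four times.
totalTime∈O : totalTime ∈O (λ n → n * ⌊log₂ n ⌋ ^ 2)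
totalTime∈O = 4 * 172 , 2 , bound
  where
  open ℕ.≤-Reasoning
  bound : ∀ n → 2 ℕ.≤ n → totalTime n ℕ.≤ 4 * 172 * (n * ⌊log₂ n ⌋ ^ 2)
  bound n 2≤n = begin
    totalTime n                       ≡⟨ four (passTime n) ⟩
    4 * passTime n                    ≤⟨ ℕ.*-monoʳ-≤ 4 pass≤ ⟩
    4 * (172 * (n * ⌊log₂ n ⌋ ^ 2))   ≡⟨ ℕ.*-assoc 4 172 m ⟨
    4 * 172 * (n * ⌊log₂ n ⌋ ^ 2)     ∎
    where
    l = ⌊log₂ n ⌋
    m = n * l ^ 2
    four : ∀ x → x ℕ.+ (x ℕ.+ (x ℕ.+ x)) ≡ 4 * x
    four = solve-∀
    1≤l : 1 ℕ.≤ l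
    1≤l = ⌊log₂⌋-mono-≤ 2≤n
    l≤l² : l ℕ.≤ l ^ 2
    l≤l² = ℕ.≤-trans (ℕ.≤-reflexive (sym (ℕ.*-identityʳ l))) (ℕ.*-monoʳ-≤ l (ℕ.≤-trans 1≤l (ℕ.≤-reflexive (sym (ℕ.*-identityʳ l)))))
    nl≤m : n * l ℕ.≤ m
    nl≤m = ℕ.*-monoʳ-≤ n l≤l²
    n≤m : n ℕ.≤ m
    n≤m = ℕ.≤-trans (ℕ.≤-trans (ℕ.≤-reflexive (sym (ℕ.*-identityʳ n))) (ℕ.*-monoʳ-≤ n 1≤l)) nl≤m
    1≤m : 1 ℕ.≤ m
    1≤m = ℕ.≤-trans (ℕ.<⇒≤ 2≤n) n≤m
    pass≤ : passTime n ℕ.≤ 172 * m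
    pass≤ = begin
      passTime n                              ≡⟨ passTime≡ n ⟩
      17 ℕ.+ 125 * n ℕ.+ 30 * (n * l)         ≤⟨ ℕ.+-mono-≤ (ℕ.+-mono-≤ (ℕ.*-monoʳ-≤ 17 1≤m) (ℕ.*-monoʳ-≤ 125 n≤m)) (ℕ.*-monoʳ-≤ 30 nl≤m) ⟩
      17 * m ℕ.+ 125 * m ℕ.+ 30 * m           ≡⟨ sum m ⟩
      172 * m                                 ∎
      where
      sum : ∀ m → 17 * m ℕ.+ 125 * m ℕ.+ 30 * m ≡ 172 * m
      sum = solve-∀

-- From one-sided slopes to Lipschitz constants.

module LipschitzConstantsCorrect {c ℓ₁ ℓ₂} (R : OrderedField c ℓ₁ ℓ₂) where
  module F = OrderedField R
  open F using (Carrier; _≈_; _<_; _≤_; _-_; -_; 0#; 1#; ∣_∣) renaming (_*_ to _·_)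
  open OrderedFieldProperties R
  open RealRAM R
  open Execution R
  open Lipschitz R
  open import Algebra.Properties.Group (CommutativeRing.+-group commutativeRing) using (⁻¹-injective)
  open import Algebra.Properties.Ring (CommutativeRing.ring commutativeRing) using (-1*x≈-x)

  -- In the form 0 ± 1 in which the machine produces the sign from `zero` and `one`.
  value : Sign → Carrier
  value Sign.+ = 0# F.+ 1#
  value Sign.- = 0# - 1#

  value-isSign : ∀ ε → IsSign (value ε)
  value-isSign Sign.+ = inj₁ (F.+-identityˡ 1#)
  value-isSign Sign.- = inj₂ (F.+-identityˡ (- 1#))

  +-value-* : ∀ x → value Sign.+ · x ≈ x
  +-value-* x = F.trans (F.*-congʳ (F.+-identityˡ 1#)) (F.*-identityˡ x)

  -‿value-* : ∀ x → value Sign.- · x ≈ - x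
  -‿value-* x = F.trans (F.*-congʳ (F.+-identityˡ (- 1#))) (-1*x≈-x x)

  value-cancel : ∀ ε {x y} → value ε · x ≈ value ε · y → x ≈ y
  value-cancel Sign.+ {x} {y} eq = F.trans (F.sym (+-value-* x)) (F.trans eq (+-value-* y))
  value-cancel Sign.- {x} {y} eq =
    ⁻¹-injective (F.trans (F.sym (-‿value-* x)) (F.trans eq (-‿value-* y)))

  0≤value*⇒∣∣≤ : ∀ ε {x} → 0# ≤ value ε · x → ∣ x ∣ ≤ value ε · x
  0≤value*⇒∣∣≤ ε = ∣∣-pos (value-isSign ε) _

  ∣∣≤value* : ∀ x → ∃[ δ ] ∣ x ∣ ≤ value δ · x
  ∣∣≤value* x with ≤-total 0# x
  ... | inj₁ 0≤x = Sign.+ , 0≤value*⇒∣∣≤ Sign.+ (≤-resp F.refl (F.sym (+-value-* x)) 0≤x)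
  ... | inj₂ x≤0 = Sign.- , 0≤value*⇒∣∣≤ Sign.- (≤-resp F.refl (F.sym (-‿value-* x)) (x≤0⇒0≤-x x≤0))

  value-<-total : ∀ {x y} → ¬ x ≈ y → ∃[ ε ] value ε · x < value ε · y
  value-<-total {x} {y} x≉y with F.compare x y
  ... | tri< x<y _ _ = Sign.+ , <-resp (F.sym (+-value-* x)) (F.sym (+-value-* y)) x<y
  ... | tri≈ _ x≈y _ = contradiction x≈y x≉y
  ... | tri> _ _ y<x = Sign.- , <-resp (F.sym (-‿value-* x)) (F.sym (-‿value-* y)) (neg-< y<x)

  module Passes {n} (I : Instance n) where
    open Instance I

    Bounded : Sign → Sign → Fin n → Carrier → Set (ℓ₁ ⊔ ℓ₂)
    Bounded ε δ i K = ∀ j → value ε · p j < value ε · p i →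
      value δ · f i - value δ · f j ≤ K · (value ε · p i - value ε · p j)

    record Raised (ε δ : Sign) (i : Fin n) (old new : Carrier) : Set (c ⊔ ℓ₁ ⊔ ℓ₂) where
      field
        old≤new : old ≤ new
        bounded : Bounded ε δ i new
        least   : ∀ {K} → old ≤ K → Bounded ε δ i K → new ≤ K
    open Raised

    -- Only the input has to survive a pass: each pass initialises whatever else it reads, except
    -- the answers, which `Raised` tracks.
    Ready : State → Set c
    Ready s = iReg s 0 ≡ n × (∀ i → rMem s (toℕ i) ≡ p i) × (∀ i → rMem s (n ℕ.+ toℕ i) ≡ f i)

    AllRaised : Sign → Sign → State → State → Set (c ⊔ ℓ₁ ⊔ ℓ₂)
    AllRaised ε δ s s′ = Ready s′ × (∀ i → Raised ε δ i (output s n i) (output s′ n i))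

    distinct : ∀ {mem : ℕ → Carrier} → (∀ i → mem (toℕ i) ≡ p i) → ∀ ε {i j} → i ℕ.< n → j ℕ.< n →
               value ε · mem i ≈ value ε · mem j → i ≡ j
    distinct {mem} mem≡p ε i<n j<n eq = Fin.fromℕ<-injective _ _ i<n j<n (p-distinct
      (subst₂ _≈_ (at i<n) (at j<n) (value-cancel ε eq)))
      where
      at : ∀ {k} (k<n : k ℕ.< n) → mem k ≡ p (fromℕ< k<n)
      at k<n = trans (cong mem (sym (Fin.toℕ-fromℕ< k<n))) (mem≡p (fromℕ< k<n))

    module _ (ε δ : Sign) where

      -- The scan speaks of ranks, the claim of points. `exhaustive` gives every point a rank, and
      -- since keys increase with rank, the points with smaller key are exactly those of smaller
      -- rank.
      scanned⇒raised : ∀ {mem σ s′} (sorted : TournamentSort.Sorted R n (λ k → value ε · mem k) σ) →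
        (∀ i → mem (toℕ i) ≡ p i) → (∀ i → mem (n ℕ.+ toℕ i) ≡ f i) →
        ScanCorrect.Scanned R n (value ε) (value δ) mem σ sorted s′ →
        Ready s′ × (∀ i → Raised ε δ i (mem (n ℕ.+ n ℕ.+ toℕ i)) (output s′ n i))
      scanned⇒raised {mem} {σ} {s′} sorted mem≡p mem≡f (E , maxes) =
        ( n≡ E
        , (λ i → trans (given E (ℕ.<-≤-trans (Fin.toℕ<n i) (ℕ.m≤m+n n n))) (mem≡p i))
        , (λ i → trans (given E (ℕ.+-monoʳ-< n (Fin.toℕ<n i))) (mem≡f i))) ,
        raised
        where
        open ScanCorrect R n (value ε) (value δ) mem σ sorted
        open Env
        open TournamentSort.Sorted sorted
        open SlopeScan R X Y
        open Slopes X Y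

        raised : ∀ i → Raised ε δ i (mem (n ℕ.+ n ℕ.+ toℕ i)) (output s′ n i)
        raised i with exhaustive (Fin.toℕ<n i)
        ... | k , k<n , σk≡i = subst (λ a → Raised ε δ i (mem (n ℕ.+ n ℕ.+ a)) (rMem s′ (n ℕ.+ n ℕ.+ a))) σk≡i record
          { old≤new = IsMaxSlope.old≤new max
          ; bounded = λ j j<i → let l , l<n , σl≡j = exhaustive (Fin.toℕ<n j) in
              subst (λ q → q) (below≡ l σl≡j) (IsMaxSlope.bounds max (rank< l<n (subst₂ _<_ (sym (x≡ l σl≡j)) (sym (x≡ k σk≡i)) j<i)))
          ; least   = λ old≤K bounded → IsMaxSlope.least max old≤K λ {l} l<k →
              let j = fromℕ< (out<n (ℕ.<-trans l<k k<n)) ; σl≡j = sym (Fin.toℕ-fromℕ< (out<n (ℕ.<-trans l<k k<n))) in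
              subst (λ q → q) (sym (below≡ l σl≡j)) (bounded j (subst₂ _<_ (x≡ l σl≡j) (x≡ k σk≡i) (increasing l<k k<n)))
          }
          where
          max = maxes k<n
          x≡ : ∀ l {j} → σ l ≡ toℕ j → X l ≡ value ε · p j
          x≡ l {j} eq = cong (value ε ·_) (trans (cong mem eq) (mem≡p j))
          y≡ : ∀ l {j} → σ l ≡ toℕ j → Y l ≡ value δ · f j
          y≡ l {j} eq = cong (value δ ·_) (trans (cong (λ a → mem (n ℕ.+ a)) eq) (mem≡f j))
          below≡ : ∀ {K} l {j} → σ l ≡ toℕ j →
                   Below K l k ≡ (value δ · f i - value δ · f j ≤ K · (value ε · p i - value ε · p j))
          below≡ {K} l eq = cong₂ _≤_ (cong₂ _-_ (y≡ k σk≡i) (y≡ l eq)) (cong (K ·_) (cong₂ _-_ (x≡ k σk≡i) (x≡ l eq)))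
          rank< : ∀ {l} → l ℕ.< n → X l < X k → l ℕ.< k
          rank< {l} l<n l<k with ℕ.<-cmp l k
          ... | tri< lt _ _ = lt
          ... | tri≈ _ refl _ = contradiction l<k <-irreflexive
          ... | tri> _ _ gt = contradiction l<k (F.<-asym (increasing gt l<n))

      run-loadSigns : ∀ {s} → Runs (block (loadSigns ε δ)) s 4
        (λ s′ → rReg s′ 0 ≡ value ε × rReg s′ 1 ≡ value δ × iReg s′ ≡ iReg s × rMem s′ ≡ rMem s)
      run-loadSigns {s} = run-block (loadSigns ε δ) (enabled ε δ) (signed≡ ε _ refl refl , signed≡ δ _ refl refl , refl , refl)
        where
        -- `Enabled` reduces only once the signs, and with them the expressions `signed`, are known.
        enabled : ∀ ε δ → AllEnabled (loadSigns ε δ) s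
        enabled Sign.+ Sign.+ = _
        enabled Sign.+ Sign.- = _
        enabled Sign.- Sign.+ = _
        enabled Sign.- Sign.- = _
        signed≡ : ∀ ε s′ → rReg s′ 2 ≡ 0# → rReg s′ 3 ≡ 1# → evalᴿ (signed ε) s′ ≡ value ε
        signed≡ Sign.+ _ r₂ r₃ = cong₂ F._+_ r₂ r₃
        signed≡ Sign.- _ r₂ r₃ = cong₂ _-_ r₂ r₃

      run-pass : ∀ {s} → Ready s → Runs (pass ε δ) s (passTime n) (AllRaised ε δ s)
      run-pass {s} (n≡ , mem≡p , mem≡f) = run-seq (run-map
        (λ { s₁ (r₀ , r₁ , refl , refl) → run-seq (run-map
          (λ { s₂ (E , σ , sorted , order) → run-map
            (λ s₃ → scanned⇒raised {s′ = s₃} sorted mem≡p mem≡f)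
            (ScanCorrect.run-scan R n (value ε) (value δ) (rMem s) σ sorted (Env.regs E) (Env.mem≡ E) order) })
          (run-sort (distinct mem≡p ε) n≡ r₀ r₁ refl)) })
        run-loadSigns)
        where
        open SortCorrect R n (value ε) (value δ) (rMem s)

    scale : ∀ ε i j → value ε · p i - value ε · p j ≈ value ε · (p i - p j)
    scale ε i j = solve 3 (λ e x y → e :* x :- e :* y := e :* (x :- y)) F.refl (value ε) (p i) (p j)

    scale-f : ∀ δ i j → value δ · f i - value δ · f j ≈ value δ · (f i - f j)
    scale-f δ i j = solve 3 (λ e x y → e :* x :- e :* y := e :* (x :- y)) F.refl (value δ) (f i) (f j)

    *-monoˡ-≤ : ∀ {x y z} → 0# ≤ z → x ≤ y → z · x ≤ z · y
    *-monoˡ-≤ 0≤z x≤y = ≤-resp (F.*-comm _ _) (F.*-comm _ _) (*-monoʳ-≤ 0≤z x≤y)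

    Bounded-weaken : ∀ ε δ {i K K′} → K ≤ K′ → Bounded ε δ i K → Bounded ε δ i K′
    Bounded-weaken ε δ K≤K′ bounded j j<i =
      ≤-trans (bounded j j<i) (*-monoʳ-≤ (<⇒≤ (x<y⇒0<y-x j<i)) K≤K′)

    lipschitz⇒bounded : ∀ {i K} → 0# ≤ K → IsLipschitzAt I i K → ∀ ε δ → Bounded ε δ i K
    lipschitz⇒bounded {i} {K} 0≤K lip ε δ j j<i = ≤-trans
      (≤-resp (F.sym (scale-f δ i j)) F.refl (sign*≤∣∣ (value-isSign δ) (f i - f j)))
      (≤-trans (lip j) (*-monoˡ-≤ 0≤K (≤-trans
        (∣∣-pos (value-isSign ε) (p i - p j) (≤-resp F.refl (scale ε i j) (<⇒≤ (x<y⇒0<y-x j<i))))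
        (≤-reflexive (F.sym (scale ε i j))))))

    -- Each pair of different points is seen by some pass: δ is chosen so that δ(f i - f j) is the
    -- absolute value, and ε so that j lies to the left of i. A point paired with itself is seen by
    -- none and is treated apart.
    bounded⇒lipschitz : ∀ {i K} → 0# ≤ K → (∀ ε δ → Bounded ε δ i K) → IsLipschitzAt I i K
    bounded⇒lipschitz {i} {K} 0≤K bounded j with i Fin.≟ j
    ... | yes refl = ≤-trans
            (∣∣-pos (value-isSign Sign.+) _ (≤-reflexive (F.sym 0≈)))
            (≤-trans (≤-reflexive 0≈) (*-nonNeg 0≤K (∣x∣≥0 _)))
      where
      0≈ : value Sign.+ · (f i - f i) ≈ 0#
      0≈ = F.trans (F.*-congˡ (F.-‿inverseʳ (f i))) (F.zeroʳ _)
    ... | no i≢j with ∣∣≤value* (f i - f j) | value-<-total {p j} {p i} (λ eq → i≢j (sym (p-distinct eq)))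
    ...   | δ , ∣∣≤ | ε , j<i = ≤-trans ∣∣≤ (≤-trans
            (≤-resp (scale-f δ i j) (F.*-congˡ (scale ε i j)) (bounded ε δ j j<i))
            (*-monoˡ-≤ 0≤K (sign*≤∣∣ (value-isSign ε) (p i - p j))))

    -- Answers only grow, so the bounds of earlier passes remain valid at the end. For minimality,
    -- any nonnegative Lipschitz bound stays above the answer through each pass in turn, beginning
    -- with the 0 of an unwritten cell; this 0 is also the answer for a sole point.
    raised⇒constant : ∀ {i K₀ K₁ K₂ K₃ K₄} → K₀ ≡ 0# →
      Raised Sign.+ Sign.+ i K₀ K₁ → Raised Sign.+ Sign.- i K₁ K₂ →
      Raised Sign.- Sign.+ i K₂ K₃ → Raised Sign.- Sign.- i K₃ K₄ → IsLipschitzConstantAt I i K₄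
    raised⇒constant {i} {K₄ = K₄} refl r₁ r₂ r₃ r₄ = record
      { nonNegative = 0≤K₄
      ; isLipschitz = bounded⇒lipschitz 0≤K₄ all-bounded
      ; least = λ K′ 0≤K′ lip → let bounds = lipschitz⇒bounded 0≤K′ lip in
          least r₄ (least r₃ (least r₂ (least r₁ 0≤K′ (bounds Sign.+ Sign.+)) (bounds Sign.+ Sign.-))
            (bounds Sign.- Sign.+)) (bounds Sign.- Sign.-)
      }
      where
      K₃≤K₄ = old≤new r₄
      K₂≤K₄ = ≤-trans (old≤new r₃) K₃≤K₄
      K₁≤K₄ = ≤-trans (old≤new r₂) K₂≤K₄
      0≤K₄ = ≤-trans (old≤new r₁) K₁≤K₄
      all-bounded : ∀ ε δ → Bounded ε δ i K₄
      all-bounded Sign.+ Sign.+ = Bounded-weaken Sign.+ Sign.+ K₁≤K₄ (bounded r₁)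
      all-bounded Sign.+ Sign.- = Bounded-weaken Sign.+ Sign.- K₂≤K₄ (bounded r₂)
      all-bounded Sign.- Sign.+ = Bounded-weaken Sign.- Sign.+ K₃≤K₄ (bounded r₃)
      all-bounded Sign.- Sign.- = bounded r₄

    array-lookup : ∀ {m} (v : Vector Carrier m) i → array v (toℕ i) ≡ v i
    array-lookup {m} v i with toℕ i ℕ.<? m
    ... | yes i<m = cong v (Fin.fromℕ<-toℕ i i<m)
    ... | no i≮m = contradiction (Fin.toℕ<n i) i≮m

    array-beyond : ∀ {m} (v : Vector Carrier m) {k} → m ℕ.≤ k → array v k ≡ 0#
    array-beyond {m} v {k} m≤k with k ℕ.<? m
    ... | yes k<m = contradiction k<m (ℕ.≤⇒≯ m≤k)
    ... | no _ = refl

    ready : Ready (input I)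
    ready = refl
          , (λ i → trans (cong (array (p ++ f)) (sym (Fin.toℕ-↑ˡ i n))) (trans (array-lookup (p ++ f) (i ↑ˡ n)) (lookup-++ˡ p f i)))
          , (λ i → trans (cong (array (p ++ f)) (sym (Fin.toℕ-↑ʳ n i))) (trans (array-lookup (p ++ f) (n ↑ʳ i)) (lookup-++ʳ p f i)))

    run-lipschitzConstants : Runs lipschitzConstants (input I) (totalTime n)
                               (λ s → ∀ i → IsLipschitzConstantAt I i (output s n i))
    run-lipschitzConstants =
      run-seq (run-map (λ { _ (R₁ , r₁) →
        run-seq (run-map (λ { _ (R₂ , r₂) →
          run-seq (run-map (λ { _ (R₃ , r₃) →
            run-map (λ { _ (_ , r₄) i →
              raised⇒constant (array-beyond (p ++ f) (ℕ.m≤m+n (n ℕ.+ n) (toℕ i))) (r₁ i) (r₂ i) (r₃ i) (r₄ i) })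
            (run-pass Sign.- Sign.- R₃) })
          (run-pass Sign.- Sign.+ R₂)) })
        (run-pass Sign.+ Sign.- R₁)) })
      (run-pass Sign.+ Sign.+ ready))

proposition8p3 : ∀ {c ℓ₁ ℓ₂} (R : OrderedField c ℓ₁ ℓ₂) →
    ∃₂ λ (A : Program) (T : ℕ → ℕ) →
    T ∈O (λ n → n * ⌊log₂ n ⌋ ^ 2) ×
    RealRAM.ComputesLipschitzConstantsInTime R A T
proposition8p3 R = lipschitzConstants , totalTime , totalTime∈O , run-lipschitzConstants
  where open LipschitzConstantsCorrect.Passes R
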